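{- Let $p\in(0,1)\setminus\{\tfrac12\}$, let $n\in\mathbb{N}$, and let $\mathcal{A}=\{S\subset[n] : 1\notin S\}$. Let $\lambda\in[0,1]$ be such that $\mu_p^{(\mathbb{N})}(\mathcal{L}_\lambda)=1-p\ (=\mu_p^{(n)}(\mathcal{A}))$. Then $$I^p[\mathcal{A}] = 1 < I^p[\mathcal{L}_\lambda].$$
   Context: $[n]=\{1,\dots,n\}$, $\mathbb{N}=\{1,2,\dots\}$, and $\mathcal{P}(X)$ is the power set of $X$. The $p$-biased measure on $\mathcal{P}([n])$ is $\mu_p^{(n)}(\{S\}) = p^{|S|}(1-p)^{n-|S|}$. $\Sigma$ is the $\sigma$-algebra on $\mathcal{P}(\mathbb{N})\cong\{0,1\}^{\mathbb{N}}$ generated by the families depending on only finitely many coordinates, and $\mu_p^{(\mathbb{N})}$ is the $p$-biased product measure on $(\mathcal{P}(\mathbb{N}),\Sigma)$ (each $j\in\mathbb{N}$ is included in the random set independently with probability $p$). Influences: for $\mathcal{F}\subset\mathcal{P}([n])$ and $i\in[n]$, $I_i^p[\mathcal{F}] := \Pr_{S\sim\mu_p^{(n)}}[\,|\mathcal{F}\cap\{S,S\Delta\{i\}\}|=1\,]$ and $I^p[\mathcal{F}]:=\sum_{i=1}^n I_i^p[\mathcal{F}]$. For $\mathcal{F}\in\Sigma$ and $i\in\mathbb{N}$, $I_i^p[\mathcal{F}] := \Pr_{S\sim\mu_p^{(\mathbb{N})}}[\,|\mathcal{F}\cap\{S,S\Delta\{i\}\}|=1\,]$ and $I^p[\mathcal{F}]:=\sum_{i=1}^\infty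 I_i^p[\mathcal{F}]$. Lexicographic families $\mathcal{L}_\lambda\subset\mathcal{P}(\mathbb{N})$: $\mathcal{L}_0=\emptyset$, $\mathcal{L}_1=\mathcal{P}(\mathbb{N})$. For $\lambda\in(0,1)$, let $\lambda=\sum_j 2^{ -i_j}$ with $1\le i_1<i_2<\cdots$ be its binary expansion (the finite one if $\lambda$ is a dyadic rational), and define $\mathcal{L}_\lambda := \bigcup_j\{S\subset\mathbb{N} : S\cap[i_j] = [i_j]\setminus\{i_k : k<j\}\}$. (This is the initial segment, with $\mu_{1/2}^{(\mathbb{N})}$-measure $\lambda$, of the lexicographic ordering on $\mathcal{P}(\mathbb{N})$ given by $S>T$ iff $\min(S\Delta T)\in S$, initial segments consisting of the largest elements.) -}

module Defs where

open import Algebra.Bundles using (CommutativeRing; Semiring)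
import Algebra.Definitions.RawSemiring as RawSemiringDefs
open import Axiom.ExcludedMiddle using (ExcludedMiddle)
open import Data.Bool using (Bool; true; false; not; if_then_else_)
open import Data.Fin using (Fin; toℕ)
import Data.Fin as Fin
open import Data.Fin.Subset as Sub using (Subset; inside; outside; ∣_∣)
open import Data.List using (List; []; _∷_; _++_; map; foldr)
open import Data.Nat as ℕ using (ℕ; zero; suc; _∸_)
open import Data.Product using (∃-syntax; _×_; _,_)
open import Data.Sum using (_⊎_)
open import Data.Unit using (⊤)
open import Data.Vec using (lookup; _[_]%=_)
import Data.Vec as Vec
open import Function using (_⇔_)
open import Level using (0ℓ) renaming (suc to lsuc)
open import Relation.Binary using (Rel; IsTotalOrder)
import Relation.Binary.Construct.NonStrictToStrict as ToStrict
open import Relation.Binary.PropositionalEquality using (_≡_)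
open import Relation.Nullary using (¬_; yes; no; does)
open import Relation.Unary as U using (Pred; ∅; ∁; ⋃; _≐_; _∈_)

-- The standard library has no real numbers, so ℝ is axiomatised by the
-- properties that characterise it up to isomorphism.  As usual, _⁻¹ is a total
-- operation and x ⁻¹ is unspecified for x ≈ 0#.
record CompleteOrderedField : Set₁ where
  infix  8 _⁻¹
  infix  4 _≤_
  field
    commutativeRing : CommutativeRing 0ℓ 0ℓ
  open CommutativeRing commutativeRing public
  field
    _⁻¹          : Carrier → Carrier
    ⁻¹-inverseʳ  : ∀ x → ¬ x ≈ 0# → x * x ⁻¹ ≈ 1#
    0≉1          : ¬ 0# ≈ 1#
    _≤_          : Rel Carrier 0ℓ
    isTotalOrder : IsTotalOrder _≈_ _≤_
    +-monoˡ-≤    : ∀ {x y} z → x ≤ y → x + z ≤ y + z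
    *-nonneg     : ∀ {x y} → 0# ≤ x → 0# ≤ y → 0# ≤ x * y

  UpperBound : Pred Carrier 0ℓ → Carrier → Set
  UpperBound P b = ∀ x → x ∈ P → x ≤ b

  field
    complete : (P : Pred Carrier 0ℓ) → (∃[ x ] x ∈ P) → (∃[ b ] UpperBound P b) →
               ∃[ s ] (UpperBound P s × (∀ b → UpperBound P b → s ≤ b))

  open ToStrict _≈_ _≤_ public using (_<_)
  open RawSemiringDefs (Semiring.rawSemiring semiring) public
    using (_^_; sum) renaming (_×_ to _·_)

  ½ : Carrier
  ½ = (1# + 1#) ⁻¹

-- The mathematics is classical, so excluded middle is assumed explicitly.
module Biased (ℝ : CompleteOrderedField) (em : ExcludedMiddle 0ℓ) where

  open CompleteOrderedField ℝ

  ExactlyOne : Set → Set → Set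
  ExactlyOne P Q = (P × ¬ Q) ⊎ (¬ P × Q)

  partialSum : (ℕ → Carrier) → ℕ → Carrier
  partialSum a n = sum {n} (λ i → a (toℕ i))

  HasSum : (ℕ → Carrier) → Carrier → Set
  HasSum a x = ∀ ε → 0# < ε → ∃[ N ] (∀ n → N ℕ.≤ n →
    (x - ε < partialSum a n) × (partialSum a n < x + ε))

  data ℝ∞ : Set where
    fin : Carrier → ℝ∞
    ∞   : ℝ∞

  infix 4 _<∞_
  _<∞_ : Carrier → ℝ∞ → Set
  x <∞ fin y = x < y
  x <∞ ∞     = ⊤

  -- The value in [0,∞] of a series; meant only for nonnegative terms, where
  -- failure to converge means divergence to ∞.
  Σ∞ : (ℕ → Carrier) → ℝ∞
  Σ∞ a with em {∃[ x ] HasSum a x}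
  ... | yes (x , _) = fin x
  ... | no  _       = ∞

  -- Finite ground set: i : Fin n stands for the element toℕ i + 1 of [n].

  allSubsets : ∀ n → List (Subset n)
  allSubsets zero    = Vec.[] ∷ []
  allSubsets (suc n) = map (outside Vec.∷_) (allSubsets n)
                    ++ map (inside  Vec.∷_) (allSubsets n)

  weight : Carrier → ∀ {n} → Subset n → Carrier
  weight p {n} S = p ^ ∣ S ∣ * (1# - p) ^ (n ∸ ∣ S ∣)

  μᶠ : Carrier → ∀ {n} → Pred (Subset n) 0ℓ → Carrier
  μᶠ p {n} F = foldr _+_ 0#
    (map (λ S → if does (em {S ∈ F}) then weight p S else 0#) (allSubsets n))

  -- S [ i ]%= not is S Δ {i}.
  influenceᶠ : Carrier → ∀ {n} → Pred (Subset n) 0ℓ → Fin n → Carrier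
  influenceᶠ p F i = μᶠ p (λ S → ExactlyOne (S ∈ F) (S [ i ]%= not ∈ F))

  totalInfluenceᶠ : Carrier → ∀ {n} → Pred (Subset n) 0ℓ → Carrier
  totalInfluenceᶠ p F = sum (influenceᶠ p F)

  -- {S ⊆ [n+1] : 1 ∉ S}
  𝒜 : ∀ n → Pred (Subset (suc n)) 0ℓ
  𝒜 n S = Fin.zero Sub.∉ S

  -- Infinite ground set {1, 2, …}: k : ℕ stands for the element k + 1.

  Point : Set
  Point = ℕ → Bool

  Family : Set₁
  Family = Pred Point 0ℓ

  infix 4 _∋_
  _∋_ : Point → ℕ → Set
  S ∋ k = S k ≡ true

  -- S Δ {i}
  toggle : ℕ → Point → Point
  toggle i S k = if does (k ℕ.≟ i) then not (S k) else S k

  DependsOnFirst : ℕ → Family → Set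
  DependsOnFirst n F = ∀ S T → (∀ k → k ℕ.< n → S k ≡ T k) → S ∈ F → T ∈ F

  data Measurable : Family → Set₁ where
    finitary   : ∀ n {F} → DependsOnFirst n F → Measurable F
    complement : ∀ {F} → Measurable F → Measurable (∁ F)
    union      : ∀ {F : ℕ → Family} → (∀ i → Measurable (F i)) →
                 Measurable (⋃ ℕ F)
    resp-≐     : ∀ {F G} → F ≐ G → Measurable F → Measurable G

  cylinder : ∀ {n} → Subset n → Family
  cylinder T S = ∀ i → S (toℕ i) ≡ lookup T i

  -- μ is the p-biased product measure on Σ.  It is a total function on
  -- families, but only its values on measurable ones are constrained.
  record IsBiasedMeasure (p : Carrier) (μ : Family → Carrier) : Set₁ where
    field
      μ-cong     : ∀ {F G} → Measurable F → Measurable G → F ≐ G → μ F ≈ μ G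
      μ-nonneg   : ∀ {F} → Measurable F → 0# ≤ μ F
      μ-∅        : μ ∅ ≈ 0#
      μ-additive : (F : ℕ → Family) → (∀ i → Measurable (F i)) →
                   (∀ i j → ¬ i ≡ j → F i U.⊥ F j) →
                   HasSum (λ i → μ (F i)) (μ (⋃ ℕ F))
      μ-cylinder : ∀ {n} (T : Subset n) → μ (cylinder T) ≈ weight p T

  influence : (Family → Carrier) → Family → ℕ → Carrier
  influence μ F i = μ (λ S → ExactlyOne (S ∈ F) (toggle i S ∈ F))

  totalInfluence : (Family → Carrier) → Family → ℝ∞
  totalInfluence μ F = Σ∞ (influence μ F)

  Dyadic : Carrier → Set
  Dyadic x = ∃[ m ] ∃[ k ] x ≈ m · (½ ^ k)

  -- B is the set {i₁ < i₂ < …} of exponents; since k : ℕ stands for k + 1, its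
  -- contribution is 2^-(k+1).
  record IsBinaryExpansion (x : Carrier) (B : Point) : Set where
    field
      hasSum : HasSum (λ k → if B k then ½ ^ suc k else 0#) x
      finite : Dyadic x → ∃[ N ] (∀ k → N ℕ.≤ k → ¬ B ∋ k)

  -- S ∩ [i] = [i] ∖ {i' ∈ B : i' < i}
  LexBlock : Point → ℕ → Family
  LexBlock B i S = ∀ k → k ℕ.≤ i → S ∋ k ⇔ (¬ (B ∋ k × k ℕ.< i))

  -- For x ≈ 0# no disjunct applies, so Lex x is empty.
  Lex : Carrier → Family
  Lex x S = x ≈ 1# ⊎
            (0# < x × x < 1# ×
             ∃[ B ] (IsBinaryExpansion x B × ∃[ i ] (B ∋ i × LexBlock B i S)))

{-# OPTIONS --safe #-}

-- A lexicographic initial segment F has a boundary point c: a set leaving c at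
-- coordinate k belongs to F exactly when c k is false.  Write m k for the measure
-- of F conditioned on agreement with c below k.  If m, m' are consecutive values
-- and π is the probability of the bit c k, one finds
--   m(1 - m) + p(1-p) m'(1 - m') = p(1-p) (I/w) + π m'(1 - m'),
-- where I is the k-th influence and w the measure of the cylinder of c below k.
-- Multiplying by w and telescoping gives the Poincaré inequality
--   p(1-p) ∑ I ≥ m₀(1 - m₀)   with an extra p(1-p) m₁(1 - m₁) on the right.
-- Here m₀ = 1-p, so ∑ I ≥ 1 + m₁(1 - m₁), and p ≠ ½ keeps m₁ away from 0 and 1.

module Submission where

open import Axiom.ExcludedMiddle using (ExcludedMiddle)
open import Data.Bool using (Bool; true; false; not; if_then_else_)
import Data.Bool.Properties as Bool
open import Data.Empty using (⊥-elim)
open import Data.Fin using (toℕ)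
import Data.Fin as Fin
import Data.Fin.Properties as Fin
open import Data.Fin.Subset using (Subset; inside; outside; ∣_∣)
open import Data.Fin.Subset.Properties using (∣p∣≤n)
open import Data.List using (List; []; _∷_; _++_; map; foldr)
open import Data.Nat as ℕ using (ℕ; zero; suc; _∸_)
import Data.Nat.Properties as ℕ
open import Data.Product using (_×_; _,_; proj₁; proj₂; ∃-syntax)
open import Data.Sum using (_⊎_; inj₁; inj₂; [_,_]′)
open import Data.Unit using (⊤)
import Data.Vec as Vec
import Data.Vec.Properties as Vec
open import Function using (_∘_; _⇔_; mk⇔; Equivalence)
open import Level using (0ℓ)
open import Relation.Binary using (IsTotalOrder; TotalOrder)
open import Relation.Binary.PropositionalEquality as ≡ using (_≡_; _≢_)
import Relation.Binary.Reasoning.PartialOrder as PartialOrderReasoning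
open import Relation.Nullary using (¬_; yes; no; does)
open import Relation.Nullary.Decidable using (dec-true; dec-false)
open import Relation.Unary using (Pred; ∅; ∁; ⋃; _∪_; _∩_; _⊆_; _≐_; _⊥_; _∈_)
open import Defs

-- The influence at `k` is bounded through one symmetry: toggling `k` should rescale the measure by
-- a ratio of bit probabilities. The measure is given by its values on cylinders and by countable
-- additivity. Instead of extending the symmetry from cylinders to arbitrary measurable families,
-- the proof treats only families that contain or avoid each `D c k`, the sets first leaving `c` at
-- `k`. Such a family and its toggled copy lose proportional masses at every later coordinate, and
-- the remainders are bounded by cylinder masses that become arbitrarily small. The bit `c k`
-- decides whether the family or its complement avoids `D c k`. The estimate is made for the one
-- that does, which is why statements carry a pair `G`, `H` of complementary families.

-- Ordered-field arithmetic and consequences of completeness.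

module OrderedField (ℝ : CompleteOrderedField) where

  open CompleteOrderedField ℝ
  open IsTotalOrder isTotalOrder public
    using (total; antisym; ≤-respʳ-≈)
    renaming (refl to ≤-refl; trans to ≤-trans; reflexive to ≤-reflexive)
  open import Algebra.Properties.Ring ring
    using (+-cancelˡ; +-cancelʳ; //-rightDividesˡ; //-rightDividesʳ; -‿distribˡ-*; -‿involutive)

  totalOrder : TotalOrder 0ℓ 0ℓ 0ℓ
  totalOrder = record { isTotalOrder = isTotalOrder }

  module ≤-Reasoning = PartialOrderReasoning (TotalOrder.poset totalOrder)
  open ≤-Reasoning

  ≰⇒> : ∀ {x y} → ¬ x ≤ y → y < x
  ≰⇒> {x} {y} x≰y with total x y
  ... | inj₁ x≤y = ⊥-elim (x≰y x≤y)
  ... | inj₂ y≤x = y≤x , λ y≈x → x≰y (≤-reflexive (sym y≈x))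

  <⇒≱ : ∀ {x y} → x < y → ¬ y ≤ x
  <⇒≱ (x≤y , x≉y) y≤x = x≉y (antisym x≤y y≤x)

  +-monoʳ-≤ : ∀ {x y} z → x ≤ y → z + x ≤ z + y
  +-monoʳ-≤ {x} {y} z x≤y = begin
    z + x ≈⟨ +-comm z x ⟩
    x + z ≤⟨ +-monoˡ-≤ z x≤y ⟩
    y + z ≈⟨ +-comm y z ⟩
    z + y ∎

  +-mono-≤ : ∀ {x y u v} → x ≤ y → u ≤ v → x + u ≤ y + v
  +-mono-≤ {x} {y} {u} {v} x≤y u≤v = ≤-trans (+-monoˡ-≤ u x≤y) (+-monoʳ-≤ y u≤v)

  +-cancelʳ-≤ : ∀ {x y} z → x + z ≤ y + z → x ≤ y
  +-cancelʳ-≤ {x} {y} z x+z≤y+z = begin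
    x             ≈⟨ //-rightDividesʳ z x ⟨
    x + z - z     ≤⟨ +-monoˡ-≤ (- z) x+z≤y+z ⟩
    y + z - z     ≈⟨ //-rightDividesʳ z y ⟩
    y             ∎

  +-cancelʳ-< : ∀ {x y} z → x + z < y + z → x < y
  +-cancelʳ-< z (le , neq) = +-cancelʳ-≤ z le , λ x≈y → neq (+-congʳ x≈y)

  +-monoʳ-< : ∀ {x y} z → x < y → z + x < z + y
  +-monoʳ-< z (x≤y , x≉y) = +-monoʳ-≤ z x≤y , λ e → x≉y (+-cancelˡ z _ _ e)

  x≤x+y : ∀ {x y} → 0# ≤ y → x ≤ x + y
  x≤x+y {x} {y} 0≤y = begin
    x      ≈⟨ +-identityʳ x ⟨
    x + 0# ≤⟨ +-monoʳ-≤ x 0≤y ⟩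
    x + y  ∎

  x+[y-x]≈y : ∀ x y → x + (y - x) ≈ y
  x+[y-x]≈y x y = trans (+-comm x (y - x)) (//-rightDividesˡ x y)

  x-[x-y]≈y : ∀ x y → x - (x - y) ≈ y
  x-[x-y]≈y x y = +-cancelʳ (x - y) _ _ (trans (//-rightDividesˡ (x - y) x) (sym (x+[y-x]≈y y x)))

  x≤y⇒0≤y-x : ∀ {x y} → x ≤ y → 0# ≤ y - x
  x≤y⇒0≤y-x {x} {y} x≤y = begin
    0#    ≈⟨ -‿inverseʳ x ⟨
    x - x ≤⟨ +-monoˡ-≤ (- x) x≤y ⟩
    y - x ∎

  x<y⇒0<y-x : ∀ {x y} → x < y → 0# < y - x
  x<y⇒0<y-x {x} {y} (x≤y , x≉y) = x≤y⇒0≤y-x x≤y , λ 0≈y-x → x≉y (begin-equality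
    x           ≈⟨ +-identityʳ x ⟨
    x + 0#      ≈⟨ +-congˡ 0≈y-x ⟩
    x + (y - x) ≈⟨ x+[y-x]≈y x y ⟩
    y           ∎)

  *-monoʳ-≤ : ∀ {x y z} → 0# ≤ z → x ≤ y → z * x ≤ z * y
  *-monoʳ-≤ {x} {y} {z} 0≤z x≤y = begin
    z * x               ≤⟨ x≤x+y (*-nonneg 0≤z (x≤y⇒0≤y-x x≤y)) ⟩
    z * x + z * (y - x) ≈⟨ distribˡ z x (y - x) ⟨
    z * (x + (y - x))   ≈⟨ *-congˡ (x+[y-x]≈y x y) ⟩
    z * y               ∎

  *-monoˡ-≤ : ∀ {x y z} → 0# ≤ z → x ≤ y → x * z ≤ y * z
  *-monoˡ-≤ {x} {y} {z} 0≤z x≤y = begin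
    x * z ≈⟨ *-comm x z ⟩
    z * x ≤⟨ *-monoʳ-≤ 0≤z x≤y ⟩
    z * y ≈⟨ *-comm z y ⟩
    y * z ∎

  0≤1 : 0# ≤ 1#
  0≤1 with total 0# 1#
  ... | inj₁ 0≤1 = 0≤1
  ... | inj₂ 1≤0 = begin
    0#            ≤⟨ *-nonneg 0≤-1 0≤-1 ⟩
    - 1# * - 1#   ≈⟨ -‿distribˡ-* 1# (- 1#) ⟨
    - (1# * - 1#) ≈⟨ -‿cong (*-identityˡ (- 1#)) ⟩
    - - 1#        ≈⟨ -‿involutive 1# ⟩
    1#            ∎
    where
    0≤-1 : 0# ≤ - 1#
    0≤-1 = begin
      0#      ≤⟨ x≤y⇒0≤y-x 1≤0 ⟩
      0# - 1# ≈⟨ +-identityˡ (- 1#) ⟩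
      - 1#    ∎

  *-cancelˡ-≈ : ∀ {x y z} → ¬ z ≈ 0# → z * x ≈ z * y → x ≈ y
  *-cancelˡ-≈ {x} {y} {z} z≉0 zx≈zy = trans (sym (undo x)) (trans (*-congˡ zx≈zy) (undo y))
    where
    undo : ∀ u → z ⁻¹ * (z * u) ≈ u
    undo u = begin-equality
      z ⁻¹ * (z * u) ≈⟨ *-assoc (z ⁻¹) z u ⟨
      z ⁻¹ * z * u   ≈⟨ *-congʳ (*-comm (z ⁻¹) z) ⟩
      z * z ⁻¹ * u   ≈⟨ *-congʳ (⁻¹-inverseʳ z z≉0) ⟩
      1# * u         ≈⟨ *-identityˡ u ⟩
      u              ∎

  >⇒≉0 : ∀ {x} → 0# < x → ¬ x ≈ 0#
  >⇒≉0 (_ , 0≉x) x≈0 = 0≉x (sym x≈0)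

  *-cancelˡ-≤ : ∀ {x y z} → 0# < z → z * x ≤ z * y → x ≤ y
  *-cancelˡ-≤ {x} {y} 0<z zx≤zy with total x y
  ... | inj₁ x≤y = x≤y
  ... | inj₂ y≤x = ≤-reflexive
    (*-cancelˡ-≈ (>⇒≉0 0<z) (antisym zx≤zy (*-monoʳ-≤ (proj₁ 0<z) y≤x)))

  *-cancelˡ-< : ∀ {x y z} → 0# < z → z * x < z * y → x < y
  *-cancelˡ-< 0<z (zx≤zy , zx≉zy) = *-cancelˡ-≤ 0<z zx≤zy , λ x≈y → zx≉zy (*-congˡ x≈y)

  *-pos : ∀ {x y} → 0# < x → 0# < y → 0# < x * y
  *-pos {x} {y} 0<x 0<y = *-nonneg (proj₁ 0<x) (proj₁ 0<y) , λ 0≈xy →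
    proj₂ 0<y (*-cancelˡ-≈ (>⇒≉0 0<x) (trans (zeroʳ x) 0≈xy))

  -- One value below each `δ` is asked for, not convergence: every use compares a fixed quantity
  -- with `u n` at a single index.
  Null : (ℕ → Carrier) → Set
  Null u = ∀ δ → 0# < δ → ∃[ n ] u n < δ

  module _ (em : ExcludedMiddle 0ℓ) where

    ≯⇒≤ : ∀ {x y} → ¬ y < x → x ≤ y
    ≯⇒≤ {x} {y} y≮x with em {x ≤ y}
    ... | yes x≤y = x≤y
    ... | no  x≰y = ⊥-elim (y≮x (≰⇒> x≰y))

    -- If δ bounds u from below, the largest lower bound s satisfies s r⁻¹ ≤ s.
    contracting⇒null : ∀ {u r} → 0# < r → r < 1# → (∀ n → u (suc n) ≤ r * u n) → Null u
    contracting⇒null {u} {r} 0<r r<1 contracting δ 0<δ with em {∃[ n ] u n < δ}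
    ... | yes found = found
    ... | no none = ⊥-elim (<⇒≱ r<1 1≤r)
      where
      Lower : Carrier → Set
      Lower x = ∀ n → x ≤ u n

      δ-lower : Lower δ
      δ-lower n = ≯⇒≤ (λ un<δ → none (n , un<δ))

      supremum = complete Lower (δ , δ-lower) (u 0 , λ x low → low 0)
      s = proj₁ supremum

      s-lower : Lower s
      s-lower n = proj₂ (proj₂ supremum) (u n) (λ x low → low n)

      0<s : 0# < s
      0<s = begin-strict
        0# <⟨ 0<δ ⟩
        δ  ≤⟨ proj₁ (proj₂ supremum) δ δ-lower ⟩
        s  ∎

      r*sr⁻¹≈s : r * (s * r ⁻¹) ≈ s
      r*sr⁻¹≈s = begin-equality
        r * (s * r ⁻¹) ≈⟨ *-congˡ (*-comm s (r ⁻¹)) ⟩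
        r * (r ⁻¹ * s) ≈⟨ *-assoc r (r ⁻¹) s ⟨
        r * r ⁻¹ * s   ≈⟨ *-congʳ (⁻¹-inverseʳ r (>⇒≉0 0<r)) ⟩
        1# * s         ≈⟨ *-identityˡ s ⟩
        s              ∎

      sr⁻¹-lower : Lower (s * r ⁻¹)
      sr⁻¹-lower n = *-cancelˡ-≤ 0<r (begin
        r * (s * r ⁻¹) ≈⟨ r*sr⁻¹≈s ⟩
        s              ≤⟨ s-lower (suc n) ⟩
        u (suc n)      ≤⟨ contracting n ⟩
        r * u n        ∎)

      1≤r : 1# ≤ r
      1≤r = *-cancelˡ-≤ 0<s (begin
        s * 1#         ≈⟨ *-identityʳ s ⟩
        s              ≈⟨ r*sr⁻¹≈s ⟨
        r * (s * r ⁻¹) ≤⟨ *-monoʳ-≤ (proj₁ 0<r) (proj₁ (proj₂ supremum) _ sr⁻¹-lower) ⟩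
        r * s          ≈⟨ *-comm r s ⟩
        s * r          ∎)

    -- Both sequences lose `t n` at each step, so `a n - b n` is constant. At an index where `u` is
    -- below a supposed positive gap, `a n ≤ u n` and `0# ≤ b n` contradict it.
    equal-increments-≤ : ∀ {a b t u : ℕ → Carrier} → Null u →
                         (∀ n → a n ≈ a (suc n) + t n) → (∀ n → b n ≈ b (suc n) + t n) →
                         (∀ n → a n ≤ u n) → (∀ n → 0# ≤ b n) → a 0 ≤ b 0
    equal-increments-≤ {a} {b} {t} {u} null stepᵃ stepᵇ a≤u 0≤b = ≯⇒≤ λ b0<a0 →
      let n , un<gap = null (a 0 - b 0) (x<y⇒0<y-x b0<a0) in <⇒≱ un<gap (gap≤u n)
      where
      crossed : ∀ n → a 0 + b n ≈ b 0 + a n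
      crossed zero    = +-comm (a 0) (b 0)
      crossed (suc n) = +-cancelʳ (t n) _ _ (begin-equality
        a 0 + b (suc n) + t n   ≈⟨ +-assoc (a 0) (b (suc n)) (t n) ⟩
        a 0 + (b (suc n) + t n) ≈⟨ +-congˡ (stepᵇ n) ⟨
        a 0 + b n               ≈⟨ crossed n ⟩
        b 0 + a n               ≈⟨ +-congˡ (stepᵃ n) ⟩
        b 0 + (a (suc n) + t n) ≈⟨ +-assoc (b 0) (a (suc n)) (t n) ⟨
        b 0 + a (suc n) + t n   ∎)

      gap≤u : ∀ n → a 0 - b 0 ≤ u n
      gap≤u n = +-cancelʳ-≤ (b 0) (begin
        a 0 - b 0 + b 0 ≈⟨ //-rightDividesˡ (b 0) (a 0) ⟩
        a 0             ≤⟨ x≤x+y (0≤b n) ⟩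
        a 0 + b n       ≈⟨ crossed n ⟩
        b 0 + a n       ≤⟨ +-monoʳ-≤ (b 0) (a≤u n) ⟩
        b 0 + u n       ≈⟨ +-comm (b 0) (u n) ⟩
        u n + b 0       ∎)

    equal-increments : ∀ {a b t u : ℕ → Carrier} → Null u →
                       (∀ n → a n ≈ a (suc n) + t n) → (∀ n → b n ≈ b (suc n) + t n) →
                       (∀ n → 0# ≤ a n) → (∀ n → 0# ≤ b n) →
                       (∀ n → a n ≤ u n) → (∀ n → b n ≤ u n) → a 0 ≈ b 0
    equal-increments {a} {b} {t} null stepᵃ stepᵇ 0≤a 0≤b a≤u b≤u = antisym
      (equal-increments-≤ {a} {b} {t} null stepᵃ stepᵇ a≤u 0≤b)
      (equal-increments-≤ {b} {a} {t} null stepᵇ stepᵃ b≤u 0≤a)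

-- Series with nonnegative terms.

module Series (ℝ : CompleteOrderedField) (em : ExcludedMiddle 0ℓ) where

  open CompleteOrderedField ℝ
  open Biased ℝ em
  open OrderedField ℝ
  open ≤-Reasoning

  partialSum-mono : ∀ {a} → (∀ k → 0# ≤ a k) → ∀ {m n} → m ℕ.≤ n → partialSum a m ≤ partialSum a n
  partialSum-mono 0≤a {n = zero}  ℕ.z≤n = ≤-refl
  partialSum-mono {a} 0≤a {n = suc n} ℕ.z≤n = begin
    0#                             ≤⟨ 0≤a 0 ⟩
    a 0                            ≤⟨ x≤x+y (partialSum-mono (λ k → 0≤a (suc k)) {n = n} ℕ.z≤n) ⟩
    a 0 + partialSum (λ k → a (suc k)) n ∎
  partialSum-mono {a} 0≤a (ℕ.s≤s m≤n) = +-monoʳ-≤ (a 0) (partialSum-mono (λ k → 0≤a (suc k)) m≤n)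

  -- An `ε` equal to the supposed distance between `x` and `y` fails at an index beyond both
  -- thresholds. This is what turns countable additivity into finite additivity.
  eventually-constant-sum : ∀ {a x y} → HasSum a x → ∀ n → (∀ m → n ℕ.≤ m → partialSum a m ≈ y) → x ≈ y
  eventually-constant-sum {a} {x} {y} a-sum n const = antisym (≯⇒≤ em y≮x) (≯⇒≤ em x≮y)
    where
    y≮x : ¬ y < x
    y≮x y<x with a-sum (x - y) (x<y⇒0<y-x y<x)
    ... | N , close = <⇒≱ (proj₁ (close (n ℕ.⊔ N) (ℕ.m≤n⊔m n N))) (begin
      partialSum a (n ℕ.⊔ N) ≈⟨ const (n ℕ.⊔ N) (ℕ.m≤m⊔n n N) ⟩
      y                      ≈⟨ x-[x-y]≈y x y ⟨
      x - (x - y)            ∎)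

    x≮y : ¬ x < y
    x≮y x<y with a-sum (y - x) (x<y⇒0<y-x x<y)
    ... | N , close = <⇒≱ (proj₂ (close (n ℕ.⊔ N) (ℕ.m≤n⊔m n N))) (begin
      x + (y - x)            ≈⟨ x+[y-x]≈y x y ⟩
      y                      ≈⟨ const (n ℕ.⊔ N) (ℕ.m≤m⊔n n N) ⟨
      partialSum a (n ℕ.⊔ N) ∎)

  partialSum≤sum : ∀ {a x} → (∀ k → 0# ≤ a k) → HasSum a x → ∀ n → partialSum a n ≤ x
  partialSum≤sum {a} {x} 0≤a a-sum n = ≯⇒≤ em exceeds
    where
    exceeds : ¬ x < partialSum a n
    exceeds x<sₙ with a-sum (partialSum a n - x) (x<y⇒0<y-x x<sₙ)
    ... | N , close = <⇒≱ (proj₂ (close (n ℕ.⊔ N) (ℕ.m≤n⊔m n N))) (begin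
      x + (partialSum a n - x) ≈⟨ x+[y-x]≈y x (partialSum a n) ⟩
      partialSum a n           ≤⟨ partialSum-mono 0≤a (ℕ.m≤m⊔n n N) ⟩
      partialSum a (n ℕ.⊔ N)   ∎)

  -- Convergence of the influence series never has to be settled: without a sum the value is `∞`,
  -- and a sum of nonnegative terms dominates its partial sums.
  <partialSum⇒<Σ∞ : ∀ {a y} n → (∀ k → 0# ≤ a k) → y < partialSum a n → y <∞ Σ∞ a
  <partialSum⇒<Σ∞ {a} {y} n 0≤a y<sₙ with em {∃[ x ] HasSum a x}
  ... | no  _           = _
  ... | yes (x , a-sum) = begin-strict
    y              <⟨ y<sₙ ⟩
    partialSum a n ≤⟨ partialSum≤sum 0≤a a-sum n ⟩
    x              ∎

  telescope : ∀ {a V : ℕ → Carrier} → (∀ k → V k ≤ a k + V (suc k)) → ∀ n → V 0 ≤ partialSum a n + V n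
  telescope {V = V} step zero = ≤-reflexive (sym (+-identityˡ (V 0)))
  telescope {a} {V} step (suc n) = begin
    V 0                                          ≤⟨ step 0 ⟩
    a 0 + V 1                                    ≤⟨ +-monoʳ-≤ (a 0) (telescope (λ k → step (suc k)) n) ⟩
    a 0 + (partialSum (λ k → a (suc k)) n + V (suc n)) ≈⟨ +-assoc (a 0) _ _ ⟨
    a 0 + partialSum (λ k → a (suc k)) n + V (suc n)   ∎

-- The biased measure on a finite cube and the influence of `𝒜`.

module FiniteMeasure (ℝ : CompleteOrderedField) (em : ExcludedMiddle 0ℓ)
                     (p : CompleteOrderedField.Carrier ℝ) where

  open CompleteOrderedField ℝ
  open Biased ℝ em
  open OrderedField ℝ
  open ≤-Reasoning
  open import Algebra.Properties.Semiring.Sum semiring using (sum-cong-≋; sum-replicate-zero)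
  open import Algebra.Solver.Ring.NaturalCoefficients.Default commutativeSemiring
    using (solve; _:=_; _:*_)

  q : Carrier
  q = 1# - p

  q+p≈1 : q + p ≈ 1#
  q+p≈1 = trans (+-comm q p) (x+[y-x]≈y p 1#)

  weight-outside : ∀ {n} (S : Subset n) → weight p (outside Vec.∷ S) ≈ q * weight p S
  weight-outside {n} S = begin-equality
    -- Subtraction is truncated, so pulling out the `suc` relies on `∣ S ∣` being at most `n`.
    p ^ ∣ S ∣ * q ^ (suc n ∸ ∣ S ∣) ≡⟨ ≡.cong (λ k → p ^ ∣ S ∣ * q ^ k) (ℕ.+-∸-assoc 1 (∣p∣≤n S)) ⟩
    p ^ ∣ S ∣ * (q * q ^ (n ∸ ∣ S ∣)) ≈⟨ solve 3 (λ a b c → a :* (b :* c) := b :* (a :* c)) refl _ _ _ ⟩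
    q * (p ^ ∣ S ∣ * q ^ (n ∸ ∣ S ∣)) ∎

  weight-inside : ∀ {n} (S : Subset n) → weight p (inside Vec.∷ S) ≈ p * weight p S
  weight-inside S = *-assoc _ _ _

  private
    listSum : {A : Set} → (A → Carrier) → List A → Carrier
    listSum f xs = foldr _+_ 0# (map f xs)

    listSum-++ : {A : Set} (f : A → Carrier) (xs ys : List A) →
                 listSum f (xs ++ ys) ≈ listSum f xs + listSum f ys
    listSum-++ f []       ys = sym (+-identityˡ _)
    listSum-++ f (x ∷ xs) ys = trans (+-congˡ (listSum-++ f xs ys)) (sym (+-assoc _ _ _))

    listSum-map : {A B : Set} (c : Carrier) (f : A → Carrier) (g : B → Carrier) (h : A → B) →
                  (∀ x → g (h x) ≈ c * f x) → ∀ xs → listSum g (map h xs) ≈ c * listSum f xs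
    listSum-map c f g h scaled []       = sym (zeroʳ c)
    listSum-map c f g h scaled (x ∷ xs) =
      trans (+-cong (scaled x) (listSum-map c f g h scaled xs)) (sym (distribˡ c _ _))

    mass : ∀ {n} → Pred (Subset n) 0ℓ → Subset n → Carrier
    mass F S = if does (em {S ∈ F}) then weight p S else 0#

  μᶠ-split : ∀ {n} (F : Pred (Subset (suc n)) 0ℓ) →
             μᶠ p F ≈ q * μᶠ p (λ S → (outside Vec.∷ S) ∈ F) + p * μᶠ p (λ S → (inside Vec.∷ S) ∈ F)
  μᶠ-split {n} F = trans
    (listSum-++ (mass F) (map (outside Vec.∷_) (allSubsets n)) _)
    (+-cong (listSum-map q _ _ (outside Vec.∷_) outside-mass (allSubsets n))
            (listSum-map p _ _ (inside Vec.∷_) inside-mass (allSubsets n)))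
    where
    outside-mass : ∀ S → mass F (outside Vec.∷ S) ≈ q * mass (λ T → (outside Vec.∷ T) ∈ F) S
    -- Both indicators consult `em` at the same proposition up to unfolding, so one case split
    -- reduces both sides.
    outside-mass S with em {(outside Vec.∷ S) ∈ F}
    ... | yes _ = weight-outside S
    ... | no  _ = sym (zeroʳ q)
    inside-mass : ∀ S → mass F (inside Vec.∷ S) ≈ p * mass (λ T → (inside Vec.∷ T) ∈ F) S
    inside-mass S with em {(inside Vec.∷ S) ∈ F}
    ... | yes _ = weight-inside S
    ... | no  _ = sym (zeroʳ p)

  μᶠ-full : ∀ {n} {F : Pred (Subset n) 0ℓ} → (∀ S → S ∈ F) → μᶠ p F ≈ 1#
  μᶠ-full {zero} {F} full with em {Vec.[] ∈ F}
  ... | yes _  = trans (+-identityʳ _) (*-identityˡ 1#)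
  ... | no  ∉F = ⊥-elim (∉F (full Vec.[]))
  μᶠ-full {suc n} {F} full = begin-equality
    μᶠ p F          ≈⟨ μᶠ-split F ⟩
    q * _ + p * _   ≈⟨ +-cong (*-congˡ (μᶠ-full {n} (λ S → full _))) (*-congˡ (μᶠ-full {n} (λ S → full _))) ⟩
    q * 1# + p * 1# ≈⟨ +-cong (*-identityʳ q) (*-identityʳ p) ⟩
    q + p           ≈⟨ q+p≈1 ⟩
    1#              ∎

  μᶠ-empty : ∀ {n} {F : Pred (Subset n) 0ℓ} → (∀ S → ¬ S ∈ F) → μᶠ p F ≈ 0#
  μᶠ-empty {zero} {F} empty with em {Vec.[] ∈ F}
  ... | yes ∈F = ⊥-elim (empty Vec.[] ∈F)
  ... | no  _  = +-identityˡ 0#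
  μᶠ-empty {suc n} {F} empty = begin-equality
    μᶠ p F          ≈⟨ μᶠ-split F ⟩
    q * _ + p * _   ≈⟨ +-cong (*-congˡ (μᶠ-empty {n} (λ S → empty _))) (*-congˡ (μᶠ-empty {n} (λ S → empty _))) ⟩
    q * 0# + p * 0# ≈⟨ +-cong (zeroʳ q) (zeroʳ p) ⟩
    0# + 0#         ≈⟨ +-identityˡ 0# ⟩
    0#              ∎

  μᶠ-𝒜 : ∀ n → μᶠ p (𝒜 n) ≈ q
  μᶠ-𝒜 n = begin-equality
    μᶠ p (𝒜 n)      ≈⟨ μᶠ-split (𝒜 n) ⟩
    q * _ + p * _   ≈⟨ +-cong (*-congˡ (μᶠ-full {n} (λ S → λ ()))) (*-congˡ (μᶠ-empty {n} (λ S 1∉S → 1∉S Vec.here))) ⟩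
    q * 1# + p * 0# ≈⟨ +-cong (*-identityʳ q) (zeroʳ p) ⟩
    q + 0#          ≈⟨ +-identityʳ q ⟩
    q               ∎

  -- Membership in `𝒜 n` depends on the first coordinate alone: toggling it always changes
  -- membership, and toggling any other never does.
  totalInfluenceᶠ-𝒜 : ∀ n → totalInfluenceᶠ p (𝒜 n) ≈ 1#
  totalInfluenceᶠ-𝒜 n = begin-equality
    influenceᶠ p (𝒜 n) Fin.zero + sum (λ i → influenceᶠ p (𝒜 n) (Fin.suc i))
      ≈⟨ +-cong (μᶠ-full pivotal) (sum-cong-≋ (λ i → μᶠ-empty (irrelevant i))) ⟩
    1# + sum {n} (λ _ → 0#)  ≈⟨ +-congˡ (sum-replicate-zero n) ⟩
    1# + 0#              ≈⟨ +-identityʳ 1# ⟩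
    1#                   ∎
    where
    pivotal : ∀ S → ExactlyOne (S ∈ 𝒜 n) ((S Vec.[ Fin.zero ]%= not) ∈ 𝒜 n)
    pivotal (true  Vec.∷ S) = inj₂ ((λ 1∉S → 1∉S Vec.here) , λ ())
    pivotal (false Vec.∷ S) = inj₁ ((λ ()) , λ 1∉S → 1∉S Vec.here)
    irrelevant : ∀ i S → ¬ ExactlyOne (S ∈ 𝒜 n) ((S Vec.[ Fin.suc i ]%= not) ∈ 𝒜 n)
    irrelevant i (true  Vec.∷ S) (inj₁ (1∉S , _)) = 1∉S Vec.here
    irrelevant i (false Vec.∷ S) (inj₁ (_ , 1∈S)) = 1∈S λ ()
    irrelevant i (true  Vec.∷ S) (inj₂ (_ , 1∉S)) = 1∉S Vec.here
    irrelevant i (false Vec.∷ S) (inj₂ (1∈S , _)) = 1∈S λ ()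

-- Cylinders shrinking to a point.

module Cylinders (ℝ : CompleteOrderedField) (em : ExcludedMiddle 0ℓ) where

  open Biased ℝ em

  C : Point → ℕ → Family
  C c k S = ∀ j → j ℕ.< k → S j ≡ c j

  -- Over all `k` these partition everything except `c` itself, so a family that contains or avoids
  -- each of them is known up to one point.
  D : Point → ℕ → Family
  D c k S = C c k S × S k ≡ not (c k)

  measurable-C : ∀ c k → Measurable (C c k)
  measurable-C c k = finitary k λ S T S≡T S∈C j j<k → ≡.trans (≡.sym (S≡T j j<k)) (S∈C j j<k)

  measurable-D : ∀ c k → Measurable (D c k)
  measurable-D c k = finitary (suc k) λ S T S≡T (S∈C , Sk) →
    (λ j j<k → ≡.trans (≡.sym (S≡T j (ℕ.m<n⇒m<1+n j<k))) (S∈C j j<k))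
    , ≡.trans (≡.sym (S≡T k ℕ.≤-refl)) Sk

  C-suc : ∀ {c k S} → S ∈ C c k → S k ≡ c k → S ∈ C c (suc k)
  C-suc {k = k} S∈C Sk j (ℕ.s≤s j≤k) with ℕ.m≤n⇒m<n∨m≡n j≤k
  ... | inj₁ j<k    = S∈C j j<k
  ... | inj₂ ≡.refl = Sk

  C-pred : ∀ {c k} → C c (suc k) ⊆ C c k
  C-pred S∈C j j<k = S∈C j (ℕ.m<n⇒m<1+n j<k)

  not-≢ : ∀ b → b ≢ not b
  not-≢ true ()
  not-≢ false ()

  C⊥D : ∀ {c k} → C c (suc k) ⊥ D c k
  C⊥D {c} {k} (S∈C , _ , Sk) = not-≢ (c k) (≡.trans (≡.sym (S∈C k ℕ.≤-refl)) Sk)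

  C⊆C∪D : ∀ {c k} → C c k ⊆ C c (suc k) ∪ D c k
  C⊆C∪D {c} {k} {S} S∈C with S k Bool.≟ c k
  ... | yes Sk = inj₁ (C-suc S∈C Sk)
  ... | no  Sk = inj₂ (S∈C , Bool.¬-not Sk)

  -- Leaving `c` by dropping an element moves down the lexicographic order and out of `F`; leaving
  -- by adding one moves up and into `F`. Whether `c` itself lies in `F` is left open.
  IsBoundary : Point → Family → Set
  IsBoundary c F = ∀ k → (c k ≡ true × D c k ⊥ F) ⊎ (c k ≡ false × D c k ⊆ F)

-- Measurability and boundary points of lexicographic initial segments.

module Lexicographic (ℝ : CompleteOrderedField) (em : ExcludedMiddle 0ℓ) where

  open Biased ℝ em
  open Cylinders ℝ em

  Open : Family → Set
  Open F = ∀ {S} → S ∈ F → ∃[ n ] C S n ⊆ F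

  -- Here `d` is the minimum of the symmetric difference of `S` and `T` and belongs to `T`, so `T`
  -- is the larger of the two.
  LexUpset : Family → Set
  LexUpset F = ∀ {S T d} → T ∈ C S d → S d ≡ false → T d ≡ true → S ∈ F → T ∈ F

  -- An open family is the union over `n` of the sets `S` with `C S n ⊆ F`, and the `n`-th of these
  -- conditions sees only the first `n` coordinates. For `Lex x` this bypasses the existential
  -- quantifier over binary expansions.
  measurable-Open : ∀ {F} → Open F → Measurable F
  measurable-Open {F} open-F = resp-≐
    ((λ (n , C⊆F) → C⊆F (λ _ _ → ≡.refl)) , open-F)
    (union λ n → finitary n λ S T S≡T C⊆F U∈C →
      C⊆F (λ j j<n → ≡.trans (U∈C j j<n) (≡.sym (S≡T j j<n))))

  module _ (F : Family) where

    Deviates : Family → ℕ → Set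
    Deviates G k = ∃[ S ] (S ∈ G × S k ≡ true × ¬ S ∈ F)

    -- OnPath k is C path k, phrased so that path k can be chosen by recursion.
    OnPath : ℕ → Family
    OnPath zero    S = ⊤
    OnPath (suc k) S = S ∈ OnPath k × S k ≡ does (em {Deviates (OnPath k) k})

    -- A greedy descent: the half containing `k` is entered exactly when it is not wholly inside
    -- `F`.
    path : Point
    path k = does (em {Deviates (OnPath k) k})

    OnPath⇒C : ∀ {k} → OnPath k ⊆ C path k
    OnPath⇒C {suc k} (S∈ , Sk) = C-suc (OnPath⇒C S∈) Sk

    C⇒OnPath : ∀ {k} → C path k ⊆ OnPath k
    C⇒OnPath {zero}  _   = _
    C⇒OnPath {suc k} S∈C = C⇒OnPath (C-pred S∈C) , S∈C k ℕ.≤-refl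

    path-spec : ∀ k → (path k ≡ true × Deviates (OnPath k) k) ⊎ (path k ≡ false × ¬ Deviates (OnPath k) k)
    path-spec k with em {Deviates (OnPath k) k}
    ... | yes dev = inj₁ (≡.refl , dev)
    ... | no ¬dev = inj₂ (≡.refl , ¬dev)

    -- If the bit is `true`, a set `T` outside `F` lies above all of `D path k`, so none of
    -- `D path k` can be in `F`. If it is `false`, no set on the path containing `k` is missing from
    -- `F`, and those sets are exactly `D path k`.
    path-boundary : LexUpset F → IsBoundary path F
    path-boundary upset k with path-spec k
    ... | inj₁ (path≡true , T , T∈ , Tk , T∉F) = inj₁ (path≡true , λ ((S∈C , Sk) , S∈F) →
      T∉F (upset (λ j j<k → ≡.trans (OnPath⇒C T∈ j j<k) (≡.sym (S∈C j j<k)))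
                 (≡.trans Sk (≡.cong not path≡true)) Tk S∈F))
    ... | inj₂ (path≡false , ¬dev) = inj₂ (path≡false , D⊆F)
      where
      D⊆F : D path k ⊆ F
      D⊆F {S} (S∈C , Sk) with em {F S}
      ... | yes S∈F = S∈F
      ... | no  S∉F = ⊥-elim (¬dev (S , C⇒OnPath S∈C , ≡.trans Sk (≡.cong not path≡false) , S∉F))

  LexBlock-resp : ∀ {B i S T} → T ∈ C S (suc i) → LexBlock B i S → LexBlock B i T
  LexBlock-resp T∈C block k k≤i =
    ≡.subst (λ b → (b ≡ true) ⇔ _) (≡.sym (T∈C k (ℕ.s≤s k≤i))) (block k k≤i)

  Open-Lex : ∀ x → Open (Lex x)
  Open-Lex x (inj₁ x≈1) = 0 , λ _ → inj₁ x≈1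
  Open-Lex x (inj₂ (0<x , x<1 , B , isB , i , i∈B , block)) =
    -- A block at `i` constrains the coordinates up to and including `i`, hence the cylinder of
    -- length `suc i`.
    suc i , λ T∈C → inj₂ (0<x , x<1 , B , isB , i , i∈B , LexBlock-resp T∈C block)

  -- If the first difference `d` comes after `i`, then `T` lies in the same block as `S`. Otherwise
  -- `S` lacks `d`, which its block permits only for an exponent `d` in `B` with `d < i`; `T` keeps
  -- `d` and agrees with `S` before it, so it lies in the block at `d` of the same `B`.
  LexUpset-Lex : ∀ x → LexUpset (Lex x)
  LexUpset-Lex x _ _ _ (inj₁ x≈1) = inj₁ x≈1
  LexUpset-Lex x {S} {T} {d} T∈C Sd Td (inj₂ (0<x , x<1 , B , isB , i , i∈B , block)) with d ℕ.≤? i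
  ... | no  d≰i = inj₂ (0<x , x<1 , B , isB , i , i∈B ,
    LexBlock-resp (λ j j<1+i → T∈C j (ℕ.<-≤-trans j<1+i (ℕ.≰⇒> d≰i))) block)
  ... | yes d≤i = inj₂ (0<x , x<1 , B , isB , d , proj₁ d∈B , block-d)
    where
    d∈B : B ∋ d × d ℕ.< i
    d∈B with em {B ∋ d × d ℕ.< i}
    ... | yes d∈B = d∈B
    ... | no  d∉B with () ← ≡.trans (≡.sym Sd) (Equivalence.from (block d d≤i) d∉B)

    block-d : LexBlock B d T
    block-d k k≤d with ℕ.m≤n⇒m<n∨m≡n k≤d
    ... | inj₂ ≡.refl = mk⇔ (λ _ (_ , d<d) → ℕ.<-irrefl ≡.refl d<d) (λ _ → Td)
    ... | inj₁ k<d = mk⇔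
      (λ Tk (k∈B , _) → Equivalence.to (block k k≤i) (≡.trans (≡.sym (T∈C k k<d)) Tk) (k∈B , ℕ.<-≤-trans k<d d≤i))
      (λ k∉B → ≡.trans (T∈C k k<d) (Equivalence.from (block k k≤i) λ (k∈B , _) → k∉B (k∈B , k<d)))
      where k≤i = ℕ.≤-trans k≤d d≤i

-- Finite additivity and the masses of cylinders.

module BiasedMeasure (ℝ : CompleteOrderedField) (em : ExcludedMiddle 0ℓ)
    (p : CompleteOrderedField.Carrier ℝ)
    (μ : Biased.Family ℝ em → CompleteOrderedField.Carrier ℝ)
    (isBiased : Biased.IsBiasedMeasure ℝ em p μ) where

  open CompleteOrderedField ℝ
  open Biased ℝ em
  open OrderedField ℝ
  open ≤-Reasoning
  open Series ℝ em
  open FiniteMeasure ℝ em p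
  open Cylinders ℝ em
  open IsBiasedMeasure isBiased
  open import Algebra.Properties.Ring ring using (+-cancelˡ)

  private
    pair : Family → Family → ℕ → Family
    pair F G 0             = F
    pair F G 1             = G
    pair F G (suc (suc _)) = ∅

  measurable-∅ : Measurable ∅
  measurable-∅ = finitary 0 (λ _ _ _ ())

  measurable-pair : ∀ {F G} → Measurable F → Measurable G → ∀ i → Measurable (pair F G i)
  measurable-pair mF mG 0             = mF
  measurable-pair mF mG 1             = mG
  measurable-pair mF mG (suc (suc _)) = measurable-∅

  ⋃-pair : ∀ {F G} → ⋃ ℕ (pair F G) ≐ F ∪ G
  ⋃-pair = (λ { (0 , x) → inj₁ x ; (1 , x) → inj₂ x ; (suc (suc _) , ()) })
         , (λ { (inj₁ x) → 0 , x ; (inj₂ x) → 1 , x })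

  measurable-∪ : ∀ {F G} → Measurable F → Measurable G → Measurable (F ∪ G)
  measurable-∪ mF mG = resp-≐ ⋃-pair (union (measurable-pair mF mG))

  measurable-∩ : ∀ {F G} → Measurable F → Measurable G → Measurable (F ∩ G)
  measurable-∩ {F} {G} mF mG =
    resp-≐ (to , λ { (x , y) (inj₁ x∉) → x∉ x ; (x , y) (inj₂ y∉) → y∉ y })
           (complement (measurable-∪ (complement mF) (complement mG)))
    where
    to : ∁ (∁ F ∪ ∁ G) ⊆ F ∩ G
    to {S} h with em {F S} | em {G S}
    ... | yes x | yes y = x , y
    ... | no x∉ | _     = ⊥-elim (h (inj₁ x∉))
    ... | _     | no y∉ = ⊥-elim (h (inj₂ y∉))

  -- The two families are padded with `∅` to a sequence; the partial sums of its measures are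
  -- constant from length 2 on.
  μ-∪ : ∀ {F G} → Measurable F → Measurable G → F ⊥ G → μ (F ∪ G) ≈ μ F + μ G
  μ-∪ {F} {G} mF mG F⊥G = trans
    (μ-cong (measurable-∪ mF mG) (union (measurable-pair mF mG)) (proj₂ ⋃-pair , proj₁ ⋃-pair))
    (eventually-constant-sum {λ i → μ (pair F G i)} (μ-additive (pair F G) (measurable-pair mF mG) disjoint) 2 tail)
    where
    disjoint : ∀ i j → i ≢ j → pair F G i ⊥ pair F G j
    disjoint 0 0 i≢j = ⊥-elim (i≢j ≡.refl)
    disjoint 0 1 _   = F⊥G
    disjoint 1 0 _   = λ (y , x) → F⊥G (x , y)
    disjoint 1 1 i≢j = ⊥-elim (i≢j ≡.refl)
    disjoint (suc (suc _)) _ _ ()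
    disjoint 0 (suc (suc _)) _ ()
    disjoint 1 (suc (suc _)) _ ()

    zeros : ∀ n → partialSum (λ _ → μ ∅) n ≈ 0#
    zeros zero    = refl
    zeros (suc n) = trans (+-cong μ-∅ (zeros n)) (+-identityˡ 0#)

    tail : ∀ n → 2 ℕ.≤ n → partialSum (λ i → μ (pair F G i)) n ≈ μ F + μ G
    tail (suc (suc n)) (ℕ.s≤s (ℕ.s≤s _)) = begin-equality
      μ F + (μ G + partialSum (λ _ → μ ∅) n) ≈⟨ +-congˡ (+-congˡ (zeros n)) ⟩
      μ F + (μ G + 0#)                       ≈⟨ +-congˡ (+-identityʳ (μ G)) ⟩
      μ F + μ G                              ∎

  μ-split : ∀ {F G H} → Measurable F → Measurable G → Measurable H →
            F ⊥ G → H ⊆ F ∪ G → F ⊆ H → G ⊆ H → μ H ≈ μ F + μ G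
  μ-split mF mG mH F⊥G H⊆ F⊆ G⊆ = trans
    (μ-cong mH (measurable-∪ mF mG) (H⊆ , λ { (inj₁ x) → F⊆ x ; (inj₂ y) → G⊆ y }))
    (μ-∪ mF mG F⊥G)

  μ-mono : ∀ {F G} → Measurable F → Measurable G → F ⊆ G → μ F ≤ μ G
  μ-mono {F} {G} mF mG F⊆G = begin
    μ F               ≤⟨ x≤x+y (μ-nonneg mRest) ⟩
    μ F + μ (G ∩ ∁ F) ≈⟨ μ-split mF mRest mG (λ (x , _ , x∉) → x∉ x) cover F⊆G proj₁ ⟨
    μ G               ∎
    where
    mRest : Measurable (G ∩ ∁ F)
    mRest = measurable-∩ mG (complement mF)
    cover : G ⊆ F ∪ (G ∩ ∁ F)
    cover {S} y with em {F S}
    ... | yes x = inj₁ x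
    ... | no x∉ = inj₂ (y , x∉)

  π : Bool → Carrier
  π true  = p
  π false = q

  w : Point → ℕ → Carrier
  w c zero    = 1#
  w c (suc k) = w c k * π (c k)

  prefix : Point → ∀ k → Vec.Vec Bool k
  prefix c k = Vec.tabulate (λ i → c (toℕ i))

  -- `weight` unfolds at the front of the vector while `w` grows at the last coordinate; this
  -- reconciles the two recursions.
  w-cons : ∀ c k → w c (suc k) ≈ π (c 0) * w (c ∘ suc) k
  w-cons c zero = *-comm _ _
  w-cons c (suc k) = trans (*-congʳ (w-cons c k)) (*-assoc _ _ _)

  weight-prefix : ∀ c k → weight p (prefix c k) ≈ w c k
  weight-prefix c zero = *-identityˡ 1#
  weight-prefix c (suc k) = trans
    (weight-cons (c 0) (prefix (c ∘ suc) k))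
    (trans (*-congˡ (weight-prefix (c ∘ suc) k)) (sym (w-cons c k)))
    where
    weight-cons : ∀ b {n} (S : Vec.Vec Bool n) → weight p (b Vec.∷ S) ≈ π b * weight p S
    weight-cons true  = weight-inside
    weight-cons false = weight-outside

  cylinder≐C : ∀ c k → cylinder (prefix c k) ≐ C c k
  cylinder≐C c k =
    (λ {S} S∈ j j<k → ≡.subst (λ i → S i ≡ c i) (Fin.toℕ-fromℕ< j<k)
      (≡.trans (S∈ (Fin.fromℕ< j<k)) (Vec.lookup∘tabulate _ (Fin.fromℕ< j<k))))
    , λ S∈C i → ≡.trans (S∈C (toℕ i) (Fin.toℕ<n i)) (≡.sym (Vec.lookup∘tabulate _ i))

  μ-C : ∀ c k → μ (C c k) ≈ w c k
  μ-C c k = begin-equality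
    μ (C c k)                 ≈⟨ μ-cong (resp-≐ (proj₂ ≐ , proj₁ ≐) (measurable-C c k)) (measurable-C c k) ≐ ⟨
    μ (cylinder (prefix c k)) ≈⟨ μ-cylinder (prefix c k) ⟩
    weight p (prefix c k)     ≈⟨ weight-prefix c k ⟩
    w c k                     ∎
    where ≐ = cylinder≐C c k

  π-not : ∀ b → π b + π (not b) ≈ 1#
  π-not true  = trans (+-comm p q) q+p≈1
  π-not false = q+p≈1

  -- `D c k` is what `C c k` loses on passing to `C c (suc k)`, so its mass follows by cancellation.
  μ-D : ∀ c k → μ (D c k) ≈ w c k * π (not (c k))
  μ-D c k = +-cancelˡ (w c (suc k)) _ _ (begin-equality
    w c (suc k) + μ (D c k)                 ≈⟨ +-congʳ (μ-C c (suc k)) ⟨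
    μ (C c (suc k)) + μ (D c k)             ≈⟨ μ-split (measurable-C c (suc k)) (measurable-D c k) (measurable-C c k)
                                                 (λ {S} → C⊥D {c} {k} {S}) (C⊆C∪D {c} {k}) C-pred proj₁ ⟨
    μ (C c k)                               ≈⟨ μ-C c k ⟩
    w c k                                   ≈⟨ *-identityʳ _ ⟨
    w c k * 1#                              ≈⟨ *-congˡ (π-not (c k)) ⟨
    w c k * (π (c k) + π (not (c k)))       ≈⟨ distribˡ _ _ _ ⟩
    w c (suc k) + w c k * π (not (c k))     ∎)

-- Toggling a coordinate and a lower bound for one influence.

module Influence (ℝ : CompleteOrderedField) (em : ExcludedMiddle 0ℓ)
    (p : CompleteOrderedField.Carrier ℝ)
    (0<p : CompleteOrderedField._<_ ℝ (CompleteOrderedField.0# ℝ) p)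
    (p<1 : CompleteOrderedField._<_ ℝ p (CompleteOrderedField.1# ℝ))
    (μ : Biased.Family ℝ em → CompleteOrderedField.Carrier ℝ)
    (isBiased : Biased.IsBiasedMeasure ℝ em p μ) where

  open CompleteOrderedField ℝ
  open Biased ℝ em
  open OrderedField ℝ
  open ≤-Reasoning
  open FiniteMeasure ℝ em p
  open IsBiasedMeasure isBiased
  open Cylinders ℝ em
  open BiasedMeasure ℝ em p μ isBiased
  open import Algebra.Solver.Ring.NaturalCoefficients.Default commutativeSemiring
    using (solve; _:=_; _:*_)

  0<q : 0# < q
  0<q = x<y⇒0<y-x p<1

  π-pos : ∀ b → 0# < π b
  π-pos true  = 0<p
  π-pos false = 0<q

  0≤π : ∀ b → 0# ≤ π b
  0≤π b = proj₁ (π-pos b)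

  q<1 : q < 1#
  q<1 = +-cancelʳ-< p (begin-strict
    q + p     ≈⟨ q+p≈1 ⟩
    1#        ≈⟨ +-identityʳ 1# ⟨
    1# + 0#   <⟨ +-monoʳ-< 1# 0<p ⟩
    1# + p    ∎)

  π≤1 : ∀ b → π b ≤ 1#
  π≤1 true  = proj₁ p<1
  π≤1 false = proj₁ q<1

  0≤w : ∀ c k → 0# ≤ w c k
  0≤w c k = ≤-respʳ-≈ (μ-C c k) (μ-nonneg (measurable-C c k))

  w-pos : ∀ c k → 0# < w c k
  w-pos c zero    = 0≤1 , 0≉1
  w-pos c (suc k) = *-pos (w-pos c k) (π-pos (c k))

  π-bound : ∃[ r ] (0# < r × r < 1# × (∀ b → π b ≤ r))
  π-bound with total p q
  ... | inj₁ p≤q = q , 0<q , q<1 , λ { true → p≤q ; false → ≤-refl }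
  ... | inj₂ q≤p = p , 0<p , p<1 , λ { true → ≤-refl ; false → q≤p }

  -- Each further coordinate multiplies the mass by at most the larger of `p` and `q`, which is
  -- below 1. The shift `i` lets a descent start below a given coordinate.
  w-null : ∀ c i → Null (λ n → w c (n ℕ.+ i))
  w-null c i = let r , 0<r , r<1 , π≤r = π-bound in
    contracting⇒null em 0<r r<1 λ n → begin
      w c (n ℕ.+ i) * π (c (n ℕ.+ i)) ≤⟨ *-monoʳ-≤ (0≤w c (n ℕ.+ i)) (π≤r (c (n ℕ.+ i))) ⟩
      w c (n ℕ.+ i) * r               ≈⟨ *-comm _ r ⟩
      r * w c (n ℕ.+ i)               ∎

  μC : Family → Point → ℕ → Carrier
  μC G c k = μ (G ∩ C c k)

  measurable-∩C : ∀ {G} → Measurable G → ∀ c k → Measurable (G ∩ C c k)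
  measurable-∩C mG c k = measurable-∩ mG (measurable-C c k)

  0≤μC : ∀ {G} → Measurable G → ∀ c k → 0# ≤ μC G c k
  0≤μC mG c k = μ-nonneg (measurable-∩C mG c k)

  μC≤w : ∀ {G} → Measurable G → ∀ c k → μC G c k ≤ w c k
  μC≤w mG c k = ≤-respʳ-≈ (μ-C c k) (μ-mono (measurable-∩C mG c k) (measurable-C c k) proj₂)

  μC-⊆ : ∀ {G c k} → Measurable G → D c k ⊆ G → μC G c k ≈ μC G c (suc k) + μ (D c k)
  μC-⊆ {G} {c} {k} mG D⊆G = μ-split (measurable-∩C mG c (suc k)) (measurable-D c k) (measurable-∩C mG c k)
    (λ {S} ((_ , S∈C) , S∈D) → C⊥D {c} {k} {S} (S∈C , S∈D))
    (λ {S} (S∈G , S∈C) → [ (λ x → inj₁ (S∈G , x)) , inj₂ ]′ (C⊆C∪D {c} {k} {S} S∈C))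
    (λ (S∈G , S∈C) → S∈G , C-pred S∈C)
    (λ S∈D → D⊆G S∈D , proj₁ S∈D)

  μC-⊥ : ∀ {G c k} → Measurable G → D c k ⊥ G → μC G c k ≈ μC G c (suc k)
  μC-⊥ {G} {c} {k} mG D⊥G = μ-cong (measurable-∩C mG c k) (measurable-∩C mG c (suc k))
    ( (λ {S} (S∈G , S∈C) → S∈G ,
        [ (λ x → x) , (λ S∈D → ⊥-elim (D⊥G (S∈D , S∈G))) ]′ (C⊆C∪D {c} {k} {S} S∈C))
    , (λ (S∈G , S∈C) → S∈G , C-pred S∈C))

  Complementary : Family → Family → Set
  Complementary G H = G ⊥ H × (∀ S → S ∈ G ⊎ S ∈ H)

  μC-complementary : ∀ {G H} → Measurable G → Measurable H → Complementary G H →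
                     ∀ c k → μC G c k + μC H c k ≈ w c k
  μC-complementary mG mH (G⊥H , cover) c k = trans
    (sym (μ-split (measurable-∩C mG c k) (measurable-∩C mH c k) (measurable-C c k)
      (λ ((x , _) , (y , _)) → G⊥H (x , y))
      (λ {S} S∈C → [ (λ x → inj₁ (x , S∈C)) , (λ y → inj₂ (y , S∈C)) ]′ (cover S))
      proj₂ proj₂))
    (μ-C c k)

  toggle-at : ∀ i S → toggle i S i ≡ not (S i)
  toggle-at i S rewrite dec-true (i ℕ.≟ i) ≡.refl = ≡.refl

  toggle-off : ∀ {i k} S → k ≢ i → toggle i S k ≡ S k
  toggle-off {i} {k} S k≢i rewrite dec-false (k ℕ.≟ i) k≢i = ≡.refl

  toggle-cong : ∀ i {S T k} → S k ≡ T k → toggle i S k ≡ toggle i T k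
  toggle-cong i {k = k} Sk≡Tk with does (k ℕ.≟ i)
  ... | true  = ≡.cong not Sk≡Tk
  ... | false = Sk≡Tk

  toggle-involutive : ∀ i S k → toggle i (toggle i S) k ≡ S k
  toggle-involutive i S k with k ℕ.≟ i
  ... | yes ≡.refl = ≡.trans (toggle-at i (toggle i S)) (≡.trans (≡.cong not (toggle-at i S)) (Bool.not-involutive (S i)))
  ... | no  k≢i    = ≡.trans (toggle-off (toggle i S) k≢i) (toggle-off S k≢i)

  toggled : ℕ → Family → Family
  toggled i G S = toggle i S ∈ G

  -- Preimages under toggling commute definitionally with complements and unions, so only the
  -- finitary case needs an argument.
  measurable-toggled : ∀ i {G} → Measurable G → Measurable (toggled i G)
  measurable-toggled i (finitary n dep) = finitary n λ S T S≡T →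
    dep (toggle i S) (toggle i T) (λ k k<n → toggle-cong i {S} {T} (S≡T k k<n))
  measurable-toggled i (complement mG)  = complement (measurable-toggled i mG)
  measurable-toggled i (union mG)       = union (λ j → measurable-toggled i (mG j))
  measurable-toggled i (resp-≐ (⊆ , ⊇) mG) = resp-≐ (⊆ , ⊇) (measurable-toggled i mG)

  toggle-C : ∀ {i c k S} → S ∈ C (toggle i c) k → toggle i S ∈ C c k
  toggle-C {i} {c} {k} {S} S∈C j j<k =
    ≡.trans (toggle-cong i {S} {toggle i c} (S∈C j j<k)) (toggle-involutive i c j)

  toggle-D : ∀ {i c k S} → S ∈ D (toggle i c) k → k ≢ i → toggle i S ∈ D c k
  toggle-D {i} {c} {k} {S} (S∈C , Sk) k≢i = toggle-C S∈C ,
    ≡.trans (toggle-off S k≢i) (≡.trans Sk (≡.cong not (toggle-off c k≢i)))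

  w-toggle-≤ : ∀ {i c} k → k ℕ.≤ i → w (toggle i c) k ≡ w c k
  w-toggle-≤ zero _ = ≡.refl
  w-toggle-≤ {c = c} (suc k) k<i =
    ≡.cong₂ (λ x b → x * π b) (w-toggle-≤ k (ℕ.<⇒≤ k<i)) (toggle-off c (ℕ.<⇒≢ k<i))

  +suc≢ : ∀ n i → n ℕ.+ suc i ≢ i
  +suc≢ n i n+1+i≡i = ℕ.m≢1+n+m i (≡.sym (≡.trans (≡.sym (ℕ.+-suc n i)) n+1+i≡i))

  -- Past `i` the two products differ only in the factor at `i`; cross-multiplying avoids the
  -- quotient of the two bit probabilities.
  w-toggle : ∀ i c n → w (toggle i c) (n ℕ.+ suc i) * π (c i) ≈ w c (n ℕ.+ suc i) * π (not (c i))
  w-toggle i c zero = begin-equality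
    w (toggle i c) i * π (toggle i c i) * π (c i)
      ≡⟨ ≡.cong₂ (λ x b → x * π b * π (c i)) (w-toggle-≤ {i} {c} i ℕ.≤-refl) (toggle-at i c) ⟩
    w c i * π (not (c i)) * π (c i)
      ≈⟨ solve 3 (λ x a b → x :* a :* b := x :* b :* a) refl _ _ _ ⟩
    w c i * π (c i) * π (not (c i)) ∎
  w-toggle i c (suc n) = begin-equality
    w c' k * π (c' k) * π (c i)    ≡⟨ ≡.cong (λ b → w c' k * π b * π (c i)) (toggle-off c (+suc≢ n i)) ⟩
    w c' k * π (c k) * π (c i)     ≈⟨ swap₂₃ _ _ _ ⟩
    w c' k * π (c i) * π (c k)     ≈⟨ *-congʳ (w-toggle i c n) ⟩
    w c k * π (not (c i)) * π (c k) ≈⟨ swap₂₃ _ _ _ ⟩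
    w c k * π (c k) * π (not (c i)) ∎
    where
    k = n ℕ.+ suc i
    c' = toggle i c
    swap₂₃ = solve 3 (λ x a b → x :* a :* b := x :* b :* a) refl

  -- `IsBoundary` stripped of its direction, so that it passes from a family to its complement.
  Decides : Point → Family → Set
  Decides c G = ∀ k → D c k ⊆ G ⊎ D c k ⊥ G

  -- Toggling i carries D c k to D (toggle i c) k for k > i, so going down the two
  -- points removes equal amounts, and nothing is left in the limit.
  μC-toggle : ∀ {G c} → Measurable G → Decides c G → ∀ i →
              μC G c (suc i) * π (not (c i)) ≈ μC (toggled i G) (toggle i c) (suc i) * π (c i)
  μC-toggle {G} {c} mG decided i = equal-increments em
    {λ n → μC G c (n ℕ.+ suc i) * π (not (c i))}
    {λ n → μC G' c' (n ℕ.+ suc i) * π (c i)}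
    {increment} (w-null c (suc i)) step step'
    (λ n → *-nonneg (0≤μC mG c _) (0≤π (not (c i))))
    (λ n → *-nonneg (0≤μC mG' c' _) (0≤π (c i)))
    (λ n → begin
      μC G c (n ℕ.+ suc i) * π (not (c i)) ≤⟨ *-monoˡ-≤ (0≤π (not (c i))) (μC≤w mG c _) ⟩
      w c (n ℕ.+ suc i) * π (not (c i))    ≤⟨ w*π≤w n ⟩
      w c (n ℕ.+ suc i)                    ∎)
    (λ n → begin
      μC G' c' (n ℕ.+ suc i) * π (c i)     ≤⟨ *-monoˡ-≤ (0≤π (c i)) (μC≤w mG' c' _) ⟩
      w c' (n ℕ.+ suc i) * π (c i)         ≈⟨ w-toggle i c n ⟩
      w c (n ℕ.+ suc i) * π (not (c i))    ≤⟨ w*π≤w n ⟩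
      w c (n ℕ.+ suc i)                    ∎)
    where
    G' = toggled i G
    c' = toggle i c
    mG' = measurable-toggled i mG

    w*π≤w : ∀ n → w c (n ℕ.+ suc i) * π (not (c i)) ≤ w c (n ℕ.+ suc i)
    w*π≤w n = ≤-respʳ-≈ (*-identityʳ _) (*-monoʳ-≤ (0≤w c (n ℕ.+ suc i)) (π≤1 (not (c i))))

    increment : ℕ → Carrier
    increment n = [ (λ _ → μ (D c (n ℕ.+ suc i)) * π (not (c i))) , (λ _ → 0#) ]′ (decided (n ℕ.+ suc i))

    step : ∀ n → μC G c (n ℕ.+ suc i) * π (not (c i)) ≈
                 μC G c (suc n ℕ.+ suc i) * π (not (c i)) + increment n
    step n with decided (n ℕ.+ suc i)
    ... | inj₁ D⊆G = trans (*-congʳ (μC-⊆ mG D⊆G)) (distribʳ _ _ _)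
    ... | inj₂ D⊥G = trans (*-congʳ (μC-⊥ mG D⊥G)) (sym (+-identityʳ _))

    μ-D-toggle : ∀ n → μ (D c' (n ℕ.+ suc i)) * π (c i) ≈ μ (D c (n ℕ.+ suc i)) * π (not (c i))
    μ-D-toggle n = begin-equality
      μ (D c' k) * π (c i)                ≈⟨ *-congʳ (μ-D c' k) ⟩
      w c' k * π (not (c' k)) * π (c i)
        ≡⟨ ≡.cong (λ b → w c' k * π (not b) * π (c i)) (toggle-off c (+suc≢ n i)) ⟩
      w c' k * π (not (c k)) * π (c i)    ≈⟨ swap₂₃ _ _ _ ⟩
      w c' k * π (c i) * π (not (c k))    ≈⟨ *-congʳ (w-toggle i c n) ⟩
      w c k * π (not (c i)) * π (not (c k)) ≈⟨ swap₂₃ _ _ _ ⟩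
      w c k * π (not (c k)) * π (not (c i)) ≈⟨ *-congʳ (μ-D c k) ⟨
      μ (D c k) * π (not (c i))           ∎
      where
      k = n ℕ.+ suc i
      swap₂₃ = solve 3 (λ x a b → x :* a :* b := x :* b :* a) refl

    step' : ∀ n → μC G' c' (n ℕ.+ suc i) * π (c i) ≈
                  μC G' c' (suc n ℕ.+ suc i) * π (c i) + increment n
    step' n with decided (n ℕ.+ suc i)
    ... | inj₁ D⊆G = begin-equality
      μC G' c' k * π (c i)
        ≈⟨ *-congʳ (μC-⊆ mG' (λ S∈D → D⊆G (toggle-D S∈D (+suc≢ n i)))) ⟩
      (μC G' c' (suc k) + μ (D c' k)) * π (c i)              ≈⟨ distribʳ _ _ _ ⟩
      μC G' c' (suc k) * π (c i) + μ (D c' k) * π (c i)      ≈⟨ +-congˡ (μ-D-toggle n) ⟩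
      μC G' c' (suc k) * π (c i) + μ (D c k) * π (not (c i)) ∎
      where k = n ℕ.+ suc i
    ... | inj₂ D⊥G = trans
      (*-congʳ (μC-⊥ mG' (λ (S∈D , S∈G') → D⊥G (toggle-D S∈D (+suc≢ n i) , S∈G'))))
      (sym (+-identityʳ _))

  Pivotal : Family → ℕ → Family
  Pivotal F i S = ExactlyOne (S ∈ F) (toggle i S ∈ F)

  measurable-Pivotal : ∀ {F} → Measurable F → ∀ i → Measurable (Pivotal F i)
  measurable-Pivotal mF i = measurable-∪
    (measurable-∩ mF (complement (measurable-toggled i mF)))
    (measurable-∩ (complement mF) (measurable-toggled i mF))

  Pivotal-∁ : ∀ {F i} → Pivotal (∁ F) i ⊆ Pivotal F i
  Pivotal-∁ {F} {i} {S} (inj₁ (S∉F , ¬¬)) with em {F (toggle i S)}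
  ... | yes t∈F = inj₂ (S∉F , t∈F)
  ... | no  t∉F = ⊥-elim (¬¬ t∉F)
  Pivotal-∁ {F} {i} {S} (inj₂ (¬¬ , t∉F)) with em {F S}
  ... | yes S∈F = inj₁ (S∈F , t∉F)
  ... | no  S∉F = ⊥-elim (¬¬ S∉F)

  -- Toggling `i` moves `C c (suc i)` into `D c i`, which misses `G`. Hence the part of `G` in
  -- `C c (suc i)` and its toggled copy are disjoint and both pivotal. By `μC-toggle` their masses
  -- are in the ratio of `π (c i)` to `π (not (c i))`, and these two add up to 1.
  μC≤π*μPivotal : ∀ {G c i} → Measurable G → Decides c G → D c i ⊥ G →
                  μC G c (suc i) ≤ π (c i) * μ (Pivotal G i)
  μC≤π*μPivotal {G} {c} {i} mG decided D⊥G = begin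
    μC G c (suc i)                          ≈⟨ *-identityʳ _ ⟨
    μC G c (suc i) * 1#                     ≈⟨ *-congˡ (π-not (c i)) ⟨
    μC G c (suc i) * (π (c i) + π (not (c i))) ≈⟨ distribˡ _ _ _ ⟩
    μC G c (suc i) * π (c i) + μC G c (suc i) * π (not (c i))
      ≈⟨ +-congˡ (μC-toggle mG decided i) ⟩
    μC G c (suc i) * π (c i) + μC G' c' (suc i) * π (c i) ≈⟨ distribʳ _ _ _ ⟨
    (μC G c (suc i) + μC G' c' (suc i)) * π (c i)
      ≈⟨ *-congʳ (μ-∪ mA mB disjoint) ⟨
    μ ((G ∩ C c (suc i)) ∪ (G' ∩ C c' (suc i))) * π (c i)
      ≤⟨ *-monoˡ-≤ (0≤π (c i)) (μ-mono (measurable-∪ mA mB) (measurable-Pivotal mG i) pivotal) ⟩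
    μ (Pivotal G i) * π (c i)               ≈⟨ *-comm _ _ ⟩
    π (c i) * μ (Pivotal G i)               ∎
    where
    G' = toggled i G
    c' = toggle i c
    mA = measurable-∩C mG c (suc i)
    mB = measurable-∩C (measurable-toggled i mG) c' (suc i)

    C'⊆D : C c' (suc i) ⊆ D c i
    C'⊆D {S} S∈C' =
      (λ j j<i → ≡.trans (S∈C' j (ℕ.m<n⇒m<1+n j<i)) (toggle-off c (ℕ.<⇒≢ j<i)))
      , ≡.trans (S∈C' i ℕ.≤-refl) (toggle-at i c)

    toggle-C⊆D : ∀ {S} → S ∈ C c (suc i) → toggle i S ∈ D c i
    toggle-C⊆D {S} S∈C =
      (λ j j<i → ≡.trans (toggle-off S (ℕ.<⇒≢ j<i)) (S∈C j (ℕ.m<n⇒m<1+n j<i)))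
      , ≡.trans (toggle-at i S) (≡.cong not (S∈C i ℕ.≤-refl))

    disjoint : (G ∩ C c (suc i)) ⊥ (G' ∩ C c' (suc i))
    disjoint {S} ((_ , S∈C) , (_ , S∈C')) = C⊥D {c} {i} {S} (S∈C , C'⊆D S∈C')

    pivotal : (G ∩ C c (suc i)) ∪ (G' ∩ C c' (suc i)) ⊆ Pivotal G i
    pivotal (inj₁ (S∈G , S∈C))  = inj₁ (S∈G , λ t∈G → D⊥G (toggle-C⊆D S∈C , t∈G))
    pivotal (inj₂ (t∈G , S∈C')) = inj₂ ((λ S∈G → D⊥G (C'⊆D S∈C' , S∈G)) , t∈G)

-- Conditional densities along the boundary point and the strict Poincaré inequality.

module Boundary (ℝ : CompleteOrderedField) (em : ExcludedMiddle 0ℓ)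
    (p : CompleteOrderedField.Carrier ℝ)
    (0<p : CompleteOrderedField._<_ ℝ (CompleteOrderedField.0# ℝ) p)
    (p<1 : CompleteOrderedField._<_ ℝ p (CompleteOrderedField.1# ℝ))
    (μ : Biased.Family ℝ em → CompleteOrderedField.Carrier ℝ)
    (isBiased : Biased.IsBiasedMeasure ℝ em p μ) where

  open CompleteOrderedField ℝ
  open Biased ℝ em
  open OrderedField ℝ
  open ≤-Reasoning
  open Series ℝ em
  open FiniteMeasure ℝ em p
  open IsBiasedMeasure isBiased
  open Cylinders ℝ em
  open BiasedMeasure ℝ em p μ isBiased
  open Influence ℝ em p 0<p p<1 μ isBiased
  open import Algebra.Properties.Ring ring using (+-cancelˡ)
  open import Algebra.Properties.Semiring.Sum semiring using (*-distribˡ-sum)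
  open import Algebra.Solver.Ring.NaturalCoefficients.Default commutativeSemiring
    using (solve; _:=_; _:+_; _:*_)

  κ : Carrier
  κ = p * q

  0<κ : 0# < κ
  0<κ = *-pos 0<p 0<q

  π*π-not : ∀ b → π b * π (not b) ≈ κ
  π*π-not true  = refl
  π*π-not false = *-comm q p

  density : Point → Family → ℕ → Carrier
  density c G k = μC G c k * w c k ⁻¹

  w*density : ∀ c G k → w c k * density c G k ≈ μC G c k
  w*density c G k = begin-equality
    w c k * (μC G c k * w c k ⁻¹) ≈⟨ solve 3 (λ x y z → x :* (y :* z) := y :* (x :* z)) refl _ _ _ ⟩
    μC G c k * (w c k * w c k ⁻¹) ≈⟨ *-congˡ (⁻¹-inverseʳ _ (>⇒≉0 (w-pos c k))) ⟩
    μC G c k * 1#                 ≈⟨ *-identityʳ _ ⟩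
    μC G c k                      ∎

  *-cancelˡ-w : ∀ c k {x y} → w c k * x ≈ w c k * y → x ≈ y
  *-cancelˡ-w c k = *-cancelˡ-≈ (>⇒≉0 (w-pos c k))

  0≤density : ∀ {G} → Measurable G → ∀ c k → 0# ≤ density c G k
  0≤density {G} mG c k = *-cancelˡ-≤ (w-pos c k) (begin
    w c k * 0#            ≈⟨ zeroʳ _ ⟩
    0#                    ≤⟨ 0≤μC mG c k ⟩
    μC G c k              ≈⟨ w*density c G k ⟨
    w c k * density c G k ∎)

  density-zero : ∀ {G} → Measurable G → ∀ c → density c G 0 ≈ μ G
  density-zero {G} mG c = begin-equality
    density c G 0      ≈⟨ *-identityˡ _ ⟨
    1# * density c G 0 ≈⟨ w*density c G 0 ⟩
    μ (G ∩ C c 0)      ≈⟨ μ-cong (measurable-∩C mG c 0) mG (proj₁ , λ S∈G → S∈G , λ _ ()) ⟩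
    μ G                ∎

  density-complementary : ∀ {G H} → Measurable G → Measurable H → Complementary G H →
                          ∀ c k → density c G k + density c H k ≈ 1#
  density-complementary {G} {H} mG mH GH c k = *-cancelˡ-w c k (begin-equality
    w c k * (density c G k + density c H k)         ≈⟨ distribˡ _ _ _ ⟩
    w c k * density c G k + w c k * density c H k   ≈⟨ +-cong (w*density c G k) (w*density c H k) ⟩
    μC G c k + μC H c k                             ≈⟨ μC-complementary mG mH GH c k ⟩
    w c k                                           ≈⟨ *-identityʳ _ ⟨
    w c k * 1#                                      ∎)

  density-⊥ : ∀ {G c k} → Measurable G → D c k ⊥ G → density c G k ≈ π (c k) * density c G (suc k)
  density-⊥ {G} {c} {k} mG D⊥G = *-cancelˡ-w c k (begin-equality
    w c k * density c G k                   ≈⟨ w*density c G k ⟩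
    μC G c k                                ≈⟨ μC-⊥ mG D⊥G ⟩
    μC G c (suc k)                          ≈⟨ w*density c G (suc k) ⟨
    w c k * π (c k) * density c G (suc k)   ≈⟨ *-assoc _ _ _ ⟩
    w c k * (π (c k) * density c G (suc k)) ∎)

  density-⊆ : ∀ {G c k} → Measurable G → D c k ⊆ G →
              density c G k ≈ π (c k) * density c G (suc k) + π (not (c k))
  density-⊆ {G} {c} {k} mG D⊆G = *-cancelˡ-w c k (begin-equality
    w c k * density c G k                   ≈⟨ w*density c G k ⟩
    μC G c k                                ≈⟨ μC-⊆ mG D⊆G ⟩
    μC G c (suc k) + μ (D c k)              ≈⟨ +-cong (sym (w*density c G (suc k))) (μ-D c k) ⟩
    w c k * π (c k) * density c G (suc k) + w c k * π (not (c k))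
      ≈⟨ solve 4 (λ x a d b → x :* a :* d :+ x :* b := x :* (a :* d :+ b)) refl _ _ _ _ ⟩
    w c k * (π (c k) * density c G (suc k) + π (not (c k))) ∎)

  private
    -- The one-step identity multiplied by the cylinder mass `v`: `a` and `b` are the probabilities
    -- of following and leaving `c`, while `g` and `h` are the next densities. It is polynomial, so
    -- `a + b ≈ 1#` enters only afterwards.
    expand : ∀ v a b g h →
             v * ((a * g) * (a * h + b)) + (a * b) * (v * (g * h)) ≈ b * (v * a * g) + (a + b) * (v * a * (g * h))
    expand = solve 5 (λ v a b g h →
      v :* ((a :* g) :* (a :* h :+ b)) :+ (a :* b) :* (v :* (g :* h))
        := b :* (v :* a :* g) :+ (a :+ b) :* (v :* a :* (g :* h))) refl

  -- For complementary `G` and `H` this is `m (1 - m)`. Using the second density in place of `1 - m`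
  -- keeps the algebra free of subtraction and makes the exchange of `G` and `H` a mere commutation.
  variance : Point → Family → Family → ℕ → Carrier
  variance c G H k = density c G k * density c H k

  -- The term `b * μC G c (suc k)` left by `expand` is at most `b * a * μ (Pivotal G k)`, and
  -- `a * b` is `κ` whichever value the bit has.
  influence-step : ∀ {G H c k} → Measurable G → Measurable H → Decides c G → D c k ⊥ G → D c k ⊆ H →
    w c k * variance c G H k + κ * (w c k * variance c G H (suc k))
      ≤ κ * μ (Pivotal G k) + w c (suc k) * variance c G H (suc k)
  influence-step {G} {H} {c} {k} mG mH decided D⊥G D⊆H = begin
    v * (density c G k * density c H k) + κ * (v * (g * h))
      ≈⟨ +-cong (*-congˡ (*-cong (density-⊥ mG D⊥G) (density-⊆ mH D⊆H))) (*-congʳ (sym (π*π-not (c k)))) ⟩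
    v * ((a * g) * (a * h + b)) + (a * b) * (v * (g * h)) ≈⟨ expand v a b g h ⟩
    b * (v * a * g) + (a + b) * (v * a * (g * h))         ≈⟨ +-congˡ (trans (*-congʳ (π-not (c k))) (*-identityˡ _)) ⟩
    b * (v * a * g) + v * a * (g * h)                     ≈⟨ +-congʳ (*-congˡ (w*density c G (suc k))) ⟩
    b * μC G c (suc k) + v * a * (g * h)
      ≤⟨ +-monoˡ-≤ _ (*-monoʳ-≤ (0≤π (not (c k))) (μC≤π*μPivotal mG decided D⊥G)) ⟩
    b * (a * μ (Pivotal G k)) + v * a * (g * h)
      ≈⟨ +-congʳ (trans (sym (*-assoc _ _ _)) (*-congʳ (trans (*-comm b a) (π*π-not (c k))))) ⟩
    κ * μ (Pivotal G k) + v * a * (g * h)                 ∎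
    where
    v = w c k
    a = π (c k)
    b = π (not (c k))
    g = density c G (suc k)
    h = density c H (suc k)

  density-⊥-≉0 : ∀ {G c} → Measurable G → D c 0 ⊥ G → ¬ μ G ≈ 0# → ¬ density c G 1 ≈ 0#
  density-⊥-≉0 {G} {c} mG D⊥G μG≉0 g≈0 = μG≉0 (begin-equality
    μ G                      ≈⟨ density-zero mG c ⟨
    density c G 0            ≈⟨ density-⊥ mG D⊥G ⟩
    π (c 0) * density c G 1  ≈⟨ *-congˡ g≈0 ⟩
    π (c 0) * 0#             ≈⟨ zeroʳ _ ⟩
    0#                       ∎)

  -- If nothing of `G` remained in `C c 1`, then `G` would have exactly the mass `π (not (c 0))` of
  -- `D c 0`.
  density-⊆-≉0 : ∀ {G c} → Measurable G → D c 0 ⊆ G → ¬ μ G ≈ π (not (c 0)) → ¬ density c G 1 ≈ 0#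
  density-⊆-≉0 {G} {c} mG D⊆G μG≉π g≈0 = μG≉π (begin-equality
    μ G                                      ≈⟨ density-zero mG c ⟨
    density c G 0                            ≈⟨ density-⊆ mG D⊆G ⟩
    π (c 0) * density c G 1 + π (not (c 0))  ≈⟨ +-congʳ (trans (*-congˡ g≈0) (zeroʳ _)) ⟩
    0# + π (not (c 0))                       ≈⟨ +-identityˡ _ ⟩
    π (not (c 0))                            ∎)

  p≈q⇒p≈½ : p ≈ q → p ≈ ½
  p≈q⇒p≈½ p≈q = *-cancelˡ-≈ 2≉0 (trans 2p≈1 (sym (⁻¹-inverseʳ _ 2≉0)))
    where
    2p≈1 : (1# + 1#) * p ≈ 1#
    2p≈1 = begin-equality
      (1# + 1#) * p   ≈⟨ distribʳ p 1# 1# ⟩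
      1# * p + 1# * p ≈⟨ +-cong (*-identityˡ p) (*-identityˡ p) ⟩
      p + p           ≈⟨ +-congʳ p≈q ⟩
      q + p           ≈⟨ q+p≈1 ⟩
      1#              ∎
    -- If 2 vanished, so would `(1# + 1#) * p`, which was just shown to be 1.
    2≉0 : ¬ 1# + 1# ≈ 0#
    2≉0 2≈0 = 0≉1 (trans (sym (trans (*-congʳ 2≈0) (zeroˡ p))) 2p≈1)

  module _ {F : Family} (mF : Measurable F) {c : Point} (boundary : IsBoundary c F) where

    private
      mF∁ : Measurable (∁ F)
      mF∁ = complement mF

    F-∁-complementary : Complementary F (∁ F)
    F-∁-complementary = (λ (S∈F , S∉F) → S∉F S∈F) , cover
      where
      cover : ∀ S → S ∈ F ⊎ S ∈ ∁ F
      cover S with em {S ∈ F}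
      ... | yes S∈F = inj₁ S∈F
      ... | no  S∉F = inj₂ S∉F

    decides : Decides c F
    decides k with boundary k
    ... | inj₁ (_ , D⊥F) = inj₂ D⊥F
    ... | inj₂ (_ , D⊆F) = inj₁ D⊆F

    decides-∁ : Decides c (∁ F)
    decides-∁ k with boundary k
    ... | inj₁ (_ , D⊥F) = inj₁ (λ S∈D S∈F → D⊥F (S∈D , S∈F))
    ... | inj₂ (_ , D⊆F) = inj₂ (λ (S∈D , S∉F) → S∉F (D⊆F S∈D))

    -- `influence-step` is applied with `F` or `∁ F` as the family avoiding `D c k`; every set
    -- pivotal for `∁ F` is pivotal for `F`.
    variance-step : ∀ k →
      w c k * variance c F (∁ F) k + κ * (w c k * variance c F (∁ F) (suc k))
        ≤ κ * influence μ F k + w c (suc k) * variance c F (∁ F) (suc k)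
    variance-step k with boundary k
    ... | inj₁ (_ , D⊥F) = influence-step mF mF∁ decides D⊥F (λ S∈D S∈F → D⊥F (S∈D , S∈F))
    ... | inj₂ (_ , D⊆F) = begin
      w c k * variance c F (∁ F) k + κ * (w c k * variance c F (∁ F) (suc k))
        ≈⟨ +-cong (*-congˡ (*-comm _ _)) (*-congˡ (*-congˡ (*-comm _ _))) ⟩
      w c k * variance c (∁ F) F k + κ * (w c k * variance c (∁ F) F (suc k))
        ≤⟨ influence-step mF∁ mF decides-∁ (λ (S∈D , S∉F) → S∉F (D⊆F S∈D)) D⊆F ⟩
      κ * μ (Pivotal (∁ F) k) + w c (suc k) * variance c (∁ F) F (suc k)
        ≤⟨ +-mono-≤ (*-monoʳ-≤ (proj₁ 0<κ) (μ-mono (measurable-Pivotal mF∁ k) (measurable-Pivotal mF k) (Pivotal-∁ {F} {k})))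
                    (≤-reflexive (*-congˡ (*-comm _ _))) ⟩
      κ * influence μ F k + w c (suc k) * variance c F (∁ F) (suc k) ∎

    0≤variance : ∀ k → 0# ≤ variance c F (∁ F) k
    0≤variance k = *-nonneg (0≤density mF c k) (0≤density mF∁ c k)

    variance≤1 : ∀ k → variance c F (∁ F) k ≤ 1#
    variance≤1 k = begin
      m * n   ≤⟨ *-monoˡ-≤ (0≤density mF∁ c k) (≤-trans (x≤x+y (0≤density mF∁ c k)) m+n≤1) ⟩
      1# * n  ≈⟨ *-identityˡ n ⟩
      n       ≤⟨ x≤x+y (0≤density mF c k) ⟩
      n + m   ≈⟨ +-comm n m ⟩
      m + n   ≤⟨ m+n≤1 ⟩
      1#      ∎
      where
      m = density c F k
      n = density c (∁ F) k
      m+n≤1 : m + n ≤ 1#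
      m+n≤1 = ≤-reflexive (density-complementary mF mF∁ F-∁-complementary c k)

    module _ (μF≈q : μ F ≈ q) (p≉½ : ¬ p ≈ ½) where

      μ∁F≈p : μ (∁ F) ≈ p
      μ∁F≈p = +-cancelˡ q _ _ (begin-equality
        q + μ (∁ F)                       ≈⟨ +-cong (trans (density-zero mF c) μF≈q) (density-zero mF∁ c) ⟨
        density c F 0 + density c (∁ F) 0 ≈⟨ density-complementary mF mF∁ F-∁-complementary c 0 ⟩
        1#                                ≈⟨ q+p≈1 ⟨
        q + p                             ∎)

      variance-zero : variance c F (∁ F) 0 ≈ κ
      variance-zero = begin-equality
        density c F 0 * density c (∁ F) 0 ≈⟨ *-cong (density-zero mF c) (density-zero mF∁ c) ⟩
        μ F * μ (∁ F)                     ≈⟨ *-cong μF≈q μ∁F≈p ⟩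
        q * p                             ≈⟨ *-comm q p ⟩
        κ                                 ∎

      -- Of `F` and `∁ F`, the one avoiding `D c 0` keeps positive density because its measure is
      -- positive. The other could lose it only if its measure were that of `D c 0`, which would
      -- force `p ≈ q`.
      0<variance₁ : 0# < variance c F (∁ F) 1
      0<variance₁ = *-pos (0≤density mF c 1 , m≉0 ∘ sym) (0≤density mF∁ c 1 , n≉0 ∘ sym)
        where
        μF≉0 : ¬ μ F ≈ 0#
        μF≉0 μF≈0 = >⇒≉0 0<q (trans (sym μF≈q) μF≈0)
        μ∁F≉0 : ¬ μ (∁ F) ≈ 0#
        μ∁F≉0 μ∁F≈0 = >⇒≉0 0<p (trans (sym μ∁F≈p) μ∁F≈0)

        m≉0 : ¬ density c F 1 ≈ 0#
        m≉0 with boundary 0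
        ... | inj₁ (_ , D⊥F)    = density-⊥-≉0 mF D⊥F μF≉0
        ... | inj₂ (c0≡false , D⊆F) = density-⊆-≉0 mF D⊆F λ μF≈π → p≉½ (p≈q⇒p≈½ (begin-equality
          p             ≡⟨ ≡.cong (λ b → π (not b)) c0≡false ⟨
          π (not (c 0)) ≈⟨ μF≈π ⟨
          μ F           ≈⟨ μF≈q ⟩
          q             ∎))

        n≉0 : ¬ density c (∁ F) 1 ≈ 0#
        n≉0 with boundary 0
        ... | inj₁ (c0≡true , D⊥F) = density-⊆-≉0 mF∁ (λ S∈D S∈F → D⊥F (S∈D , S∈F)) λ μ∁F≈π →
          p≉½ (p≈q⇒p≈½ (begin-equality
            p             ≈⟨ μ∁F≈p ⟨
            μ (∁ F)       ≈⟨ μ∁F≈π ⟩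
            π (not (c 0)) ≡⟨ ≡.cong (λ b → π (not b)) c0≡true ⟩
            q             ∎))
        ... | inj₂ (_ , D⊆F) = density-⊥-≉0 mF∁ (λ (S∈D , S∉F) → S∉F (D⊆F S∈D)) μ∁F≉0

      private
        V : ℕ → Carrier
        V k = w c k * variance c F (∁ F) k

        -- The extra term of the step at coordinate 0, where `w c 0` is 1. One positive term already
        -- gives strictness, so `V-step` drops the extra terms of later steps.
        gain : Carrier
        gain = κ * variance c F (∁ F) 1

        V-step : ∀ k → V k ≤ κ * influence μ F k + V (suc k)
        V-step k = ≤-trans
          (x≤x+y (*-nonneg (proj₁ 0<κ) (*-nonneg (0≤w c k) (0≤variance (suc k)))))
          (variance-step k)

      1<totalInfluence : 1# <∞ totalInfluence μ F
      1<totalInfluence = <partialSum⇒<Σ∞ (suc N) (λ k → μ-nonneg (measurable-Pivotal mF k))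
        -- The inequality is proved multiplied by `κ` and with `gain` on both sides: on the left
        -- `gain` comes from the first step, on the right it absorbs the leftover `V (suc N)`.
        (*-cancelˡ-< 0<κ (+-cancelʳ-< gain (begin-strict
          κ * 1# + gain                ≈⟨ +-cong V₀ (*-congˡ (*-identityˡ _)) ⟨
          V 0 + κ * (1# * variance c F (∁ F) 1) ≤⟨ variance-step 0 ⟩
          κ * influence μ F 0 + V 1
            ≤⟨ +-monoʳ-≤ _ (telescope (λ k → V-step (suc k)) N) ⟩
          κ * influence μ F 0 + (partialSum (λ k → κ * influence μ F (suc k)) N + V (suc N))
            ≈⟨ +-assoc _ _ _ ⟨
          partialSum (λ k → κ * influence μ F k) (suc N) + V (suc N)
            ≈⟨ +-congʳ (*-distribˡ-sum {suc N} κ (λ i → influence μ F (toℕ i))) ⟨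
          κ * partialSum (influence μ F) (suc N) + V (suc N) <⟨ +-monoʳ-< _ V-small ⟩
          κ * partialSum (influence μ F) (suc N) + gain ∎)))
        where
        -- The shift by 1 matches the telescoping, which starts after coordinate 0; `N` is chosen so
        -- that the cylinder of length `N + 1` has mass below `gain`.
        small = w-null c 1 gain (*-pos 0<κ 0<variance₁)
        N = proj₁ small
        V₀ : V 0 ≈ κ * 1#
        V₀ = trans (*-identityˡ _) (trans variance-zero (sym (*-identityʳ κ)))
        V-small : V (suc N) < gain
        V-small = begin-strict
          w c (suc N) * variance c F (∁ F) (suc N) ≤⟨ *-monoʳ-≤ (0≤w c (suc N)) (variance≤1 (suc N)) ⟩
          w c (suc N) * 1#                         ≈⟨ *-identityʳ _ ⟩
          w c (suc N)                              ≡⟨ ≡.cong (w c) (ℕ.+-comm 1 N) ⟩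
          w c (N ℕ.+ 1)                            <⟨ proj₂ small ⟩
          gain                                     ∎

mainTheorem4 : (ℝ : CompleteOrderedField) (em : ExcludedMiddle 0ℓ) →
    let open CompleteOrderedField ℝ
        open Biased ℝ em
    in
    (p : Carrier) → 0# < p → p < 1# → ¬ (p ≈ ½) →
    (μ : Family → Carrier) → IsBiasedMeasure p μ →
    (n : ℕ) →
    (x : Carrier) → 0# ≤ x → x ≤ 1# →
    μ (Lex x) ≈ 1# - p →
    (μᶠ p (𝒜 n) ≈ 1# - p) ×
    (totalInfluenceᶠ p (𝒜 n) ≈ 1#) ×
    (1# <∞ totalInfluence μ (Lex x))
mainTheorem4 ℝ em p 0<p p<1 p≉½ μ isBiased n x _ _ μLex≈1-p =
  μᶠ-𝒜 n , totalInfluenceᶠ-𝒜 n ,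
  -- Openness of `Lex x` gives measurability, and upward closure gives the boundary point.
  1<totalInfluence (measurable-Open (Open-Lex x)) (path-boundary (Lex x) (LexUpset-Lex x)) μLex≈1-p p≉½
  where
  open Biased ℝ em using (Lex)
  open FiniteMeasure ℝ em p
  open Lexicographic ℝ em
  open Boundary ℝ em p 0<p p<1 μ isBiased
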